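{- There is an algorithm with the following guarantee. Let $h\ge 1$ and $r\ge 1$ be integers, let $P$ be a path, let $H$ be a graph, and let $G\subseteq P^h\boxtimes K_r\boxtimes H$ be an $n$-vertex graph with $|V(P)|+|V(H)|\in O(n)$, given together with this product-structure decomposition. Suppose that a $t$-track layout of $H$ with no empty tracks can be computed in $f_t(H)$ time. Then the algorithm computes a track layout of $G$ with at most $(2h+1)\cdot r\cdot t$ tracks in $O(n+h\cdot r\cdot t+f_t(H))$ time.
   Context: All graphs are finite and simple. $G\subseteq X$ means that $G$ is (isomorphic to) a subgraph of $X$. $K_r$ is the complete graph on $r$ vertices. For $i\ge 1$, the $i$-th power $X^i$ of a graph $X$ is the graph on the same vertex set in which two distinct vertices are adjacent if and only if their distance in $X$ is at most $i$. The strong product $X\boxtimes Y$ has vertex set $V(X)\times V(Y)$; distinct vertices $\langle x,y\rangle$ and $\langle x',y'\rangle$ are adjacent if and only if (a) $x=x'$ and $yy'\in E(Y)$, or (b) $y=y'$ and $xx'\in E(X)$, or (c) $xx'\in E(X)$ and $yy'\in E(Y)$. That the decomposition is given means: the path $P=(x_1,\dots,x_p)$, the graph $H$ and the integers $h,r$ are part of the input, and every vertex $v$ of $G$ stores its three coordinates in $P$, $H$ and $K_r$, accessible in constant time. A $t$-track assignment of a graph $G$ is a partition of $V(G)$ into $t$ independent sets $V_1,\dots,V_t$ (tracks), each equipped with a total order $\prec_i$. An X-crossing consists of two edges $(u,v)$ and $(u',v')$ with $u,u'\in V_i$, $v,v'\in V_j$, $i\ne j$, $u\prec_i u'$ and $v'\prec_j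 v$. A $t$-track layout is a $t$-track assignment with no X-crossing. The output layout is given by one ordered list of vertices per track. -}

module Defs where

open import Data.Fin.Base using (Fin; toℕ)
open import Data.List.Base
  using (List; []; _∷_; map; length; lookup; concat; allFin)
open import Data.List.Membership.Propositional using (_∈_)
open import Data.List.Relation.Unary.AllPairs using (AllPairs)
open import Data.List.Relation.Unary.Unique.Propositional using (Unique)
open import Data.Nat.Base using (ℕ; zero; suc; _+_; _∸_; _≤_)
open import Data.Nat.Properties using (_≟_)
open import Data.Product.Base using (Σ-syntax; ∃-syntax; _×_; _,_; proj₁; proj₂)
open import Data.Sum.Base using (_⊎_; inj₁; inj₂)
open import Function.Base using (_∘_)
open import Function.Bundles using (_⇔_)
open import Function.Definitions using (Injective)
open import Level using (0ℓ)
open import Relation.Binary.Core using (Rel)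
open import Relation.Binary.Definitions using (Symmetric; Irreflexive)
open import Relation.Binary.Structures using (IsStrictTotalOrder)
open import Relation.Binary.PropositionalEquality.Core
  using (_≡_; _≢_; refl; sym; ≢-sym)
open import Relation.Nullary.Decidable.Core using (yes; no)
open import Relation.Nullary.Negation.Core using (¬_)

------------------------------------------------------------------------
-- Graphs

record Graph (V : Set) : Set₁ where
  field
    Adj         : Rel V 0ℓ
    symmetric   : Symmetric Adj
    irreflexive : Irreflexive _≡_ Adj

module _ {V : Set} (X : Graph V) where
  open Graph X

  data Walk : ℕ → V → V → Set where
    nil  : ∀ {x} → Walk 0 x x
    cons : ∀ {d x y z} → Adj x y → Walk d y z → Walk (suc d) x z

  -- No number is the distance of two vertices in different components.
  IsDistance : V → V → ℕ → Set
  IsDistance x y d = Walk d x y × (∀ {e} → Walk e x y → d ≤ e)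

  private
    snoc : ∀ {d x y z} → Walk d x y → Adj y z → Walk (suc d) x z
    snoc nil        b = cons b nil
    snoc (cons a w) b = cons a (snoc w b)

    reverse : ∀ {d x y} → Walk d x y → Walk d y x
    reverse nil        = nil
    reverse (cons a w) = snoc (reverse w) (symmetric a)

  power : ℕ → Graph V
  power i = record
    { Adj         = λ x y → x ≢ y × ∃[ d ] (IsDistance x y d × d ≤ i)
    ; symmetric   = λ { (x≢y , d , (w , min) , d≤i) →
                        ≢-sym x≢y , d , (reverse w , min ∘ reverse) , d≤i }
    ; irreflexive = λ x≡y (x≢y , _) → x≢y x≡y
    }

infix 25 _^ᴳ_
_^ᴳ_ : ∀ {V} → Graph V → ℕ → Graph V
_^ᴳ_ = power

infixl 20 _⊠_
_⊠_ : ∀ {V W} → Graph V → Graph W → Graph (V × W)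
_⊠_ {V} {W} X Y = record
  { Adj         = adj
  ; symmetric   = λ
      { (inj₁ (x≡x′ , yy′))        → inj₁ (sym x≡x′ , Y.symmetric yy′)
      ; (inj₂ (inj₁ (y≡y′ , xx′))) → inj₂ (inj₁ (sym y≡y′ , X.symmetric xx′))
      ; (inj₂ (inj₂ (xx′ , yy′)))  →
          inj₂ (inj₂ (X.symmetric xx′ , Y.symmetric yy′))
      }
  ; irreflexive = λ
      { refl (inj₁ (_ , yy))        → Y.irreflexive refl yy
      ; refl (inj₂ (inj₁ (_ , xx))) → X.irreflexive refl xx
      ; refl (inj₂ (inj₂ (xx , _))) → X.irreflexive refl xx
      }
  }
  where
  module X = Graph X
  module Y = Graph Y
  adj : Rel (V × W) 0ℓ
  adj (x , y) (x′ , y′) =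
      (x ≡ x′ × Y.Adj y y′)
    ⊎ (y ≡ y′ × X.Adj x x′)
    ⊎ (X.Adj x x′ × Y.Adj y y′)

path : ∀ p → Graph (Fin p)
path p = record
  { Adj         = λ i j → suc (toℕ i) ≡ toℕ j ⊎ suc (toℕ j) ≡ toℕ i
  ; symmetric   = λ { (inj₁ e) → inj₂ e ; (inj₂ e) → inj₁ e }
  ; irreflexive = λ { refl (inj₁ e) → 1+n≢n e ; refl (inj₂ e) → 1+n≢n e }
  }
  where open import Data.Nat.Properties using (1+n≢n)

complete : ∀ r → Graph (Fin r)
complete r = record
  { Adj         = _≢_
  ; symmetric   = ≢-sym
  ; irreflexive = λ x≡y x≢y → x≢y x≡y
  }

infix 10 _⊆ᴳ_
record _⊆ᴳ_ {V W : Set} (G : Graph V) (X : Graph W) : Set where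
  field
    to        : V → W
    injective : Injective _≡_ _≡_ to
    preserves : ∀ {u v} → Graph.Adj G u v → Graph.Adj X (to u) (to v)

------------------------------------------------------------------------
-- Track layouts

record TrackAssignment {V : Set} (G : Graph V) (t : ℕ) : Set₁ where
  field
    track : V → Fin t

  Track : Fin t → Set
  Track i = Σ[ v ∈ V ] track v ≡ i

  field
    independent        : ∀ {u v} → track u ≡ track v → ¬ Graph.Adj G u v
    _≺_                : ∀ {i} → Rel (Track i) 0ℓ
    isStrictTotalOrder : ∀ i → IsStrictTotalOrder _≡_ (_≺_ {i})

  record XCrossing : Set where
    field
      {i j} : Fin t
      i≢j   : i ≢ j
      u u′  : Track i
      v v′  : Track j
      uv    : Graph.Adj G (proj₁ u) (proj₁ v)
      u′v′  : Graph.Adj G (proj₁ u′) (proj₁ v′)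
      u≺u′  : u ≺ u′
      v′≺v  : v′ ≺ v

record TrackLayout {V : Set} (G : Graph V) (t : ℕ) : Set₁ where
  field
    assignment : TrackAssignment G t
  open TrackAssignment assignment public
  field
    noXCrossing : ¬ XCrossing

  NoEmptyTracks : Set
  NoEmptyTracks = ∀ i → Track i

------------------------------------------------------------------------
-- Random access machine
--
-- Structured programs over the uniform-cost RAM whose only arithmetic is
-- addition and truncated subtraction.  Registers and arrays are named by
-- numerals fixed in the program text; only array cells are addressed
-- indirectly.  Every executed instruction and every evaluated test costs 1.

Reg Arr : Set
Reg = ℕ
Arr = ℕ

record Memory : Set where
  constructor mem
  field
    reg : Reg → ℕ
    arr : Arr → ℕ → ℕ
open Memory public

update : {A : Set} → (ℕ → A) → ℕ → A → ℕ → A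
update f k a j with j ≟ k
... | yes _ = a
... | no  _ = f j

setReg : Reg → ℕ → Memory → Memory
setReg x k s = mem (update (reg s) x k) (arr s)

setCell : Arr → ℕ → ℕ → Memory → Memory
setCell a i k s = mem (reg s) (update (arr s) a (update (arr s a) i k))

infixr 5 _⨟_
data Program : Set where
  skip   : Program
  const  : Reg → ℕ → Program
  add    : Reg → Reg → Reg → Program
  sub    : Reg → Reg → Reg → Program
  load   : Reg → Arr → Reg → Program
  store  : Arr → Reg → Reg → Program
  _⨟_    : Program → Program → Program
  if     : Reg → Program → Program → Program
  while  : Reg → Program → Program

-- A register counts as true when it is nonzero.
infix 4 _⊢_⇓[_]_
data _⊢_⇓[_]_ : Program → Memory → ℕ → Memory → Set where
  skip  : ∀ {s} → skip ⊢ s ⇓[ 1 ] s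
  const : ∀ {s x k} → const x k ⊢ s ⇓[ 1 ] setReg x k s
  add   : ∀ {s x y z} →
          add x y z ⊢ s ⇓[ 1 ] setReg x (reg s y + reg s z) s
  sub   : ∀ {s x y z} →
          sub x y z ⊢ s ⇓[ 1 ] setReg x (reg s y ∸ reg s z) s
  load  : ∀ {s x a y} →
          load x a y ⊢ s ⇓[ 1 ] setReg x (arr s a (reg s y)) s
  store : ∀ {s a y z} →
          store a y z ⊢ s ⇓[ 1 ] setCell a (reg s y) (reg s z) s
  seq   : ∀ {A B s s′ s″ k l} →
          A ⊢ s ⇓[ k ] s′ → B ⊢ s′ ⇓[ l ] s″ → A ⨟ B ⊢ s ⇓[ k + l ] s″
  if-true  : ∀ {x A B s s′ k} → reg s x ≢ 0 →
             A ⊢ s ⇓[ k ] s′ → if x A B ⊢ s ⇓[ suc k ] s′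
  if-false : ∀ {x A B s s′ k} → reg s x ≡ 0 →
             B ⊢ s ⇓[ k ] s′ → if x A B ⊢ s ⇓[ suc k ] s′
  while-true  : ∀ {x A s s′ s″ k l} → reg s x ≢ 0 →
                A ⊢ s ⇓[ k ] s′ → while x A ⊢ s′ ⇓[ l ] s″ →
                while x A ⊢ s ⇓[ suc (k + l) ] s″
  while-false : ∀ {x A s} → reg s x ≡ 0 → while x A ⊢ s ⇓[ 1 ] s

------------------------------------------------------------------------
-- Input and output formats

at : {A : Set} → A → List A → ℕ → A
at d []       _       = d
at d (x ∷ xs) zero    = x
at d (x ∷ xs) (suc i) = at d xs i

-- All registers and cells not listed are zero.
initial : List ℕ → List (List ℕ) → Memory
initial rs as = mem (at 0 rs) (λ a → at 0 (at [] as a))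

-- A list of lists is stored as the array of its concatenation together
-- with the array of the positions where the successive lists begin, ended
-- by the total length.
offsetsFrom : ℕ → List (List ℕ) → List ℕ
offsetsFrom k []         = k ∷ []
offsetsFrom k (xs ∷ xss) = k ∷ offsetsFrom (k + length xs) xss

offsets : List (List ℕ) → List ℕ
offsets = offsetsFrom 0

record AdjacencyLists {n} (G : Graph (Fin n)) : Set where
  field
    neighbours : Fin n → List (Fin n)
    unique     : ∀ v → Unique (neighbours v)
    correct    : ∀ u v → (v ∈ neighbours u) ⇔ Graph.Adj G u v

  rows : List (List ℕ)
  rows = map (map toℕ ∘ neighbours) (allFin n)

graphInput : ∀ {n} {G : Graph (Fin n)} → AdjacencyLists G → Memory
graphInput {n} L = initial (n ∷ []) (offsets rows ∷ concat rows ∷ [])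
  where open AdjacencyLists L

-- The vertices of P are numbered along the path, so that P is given by its
-- number of vertices, and the coordinate of a vertex in P is a position.
decompositionInput :
  ∀ {n p m} {G : Graph (Fin n)} {H : Graph (Fin m)} (h r : ℕ) →
  G ⊆ᴳ path p ^ᴳ h ⊠ complete r ⊠ H →
  AdjacencyLists G → AdjacencyLists H → Memory
decompositionInput {n} {p} {m} h r G⊆ LG LH = initial
  (n ∷ m ∷ p ∷ h ∷ r ∷ [])
  ( offsets (rows LG) ∷ concat (rows LG)
  ∷ offsets (rows LH) ∷ concat (rows LH)
  ∷ coordinate (toℕ ∘ proj₁ ∘ proj₁)
  ∷ coordinate (toℕ ∘ proj₂ ∘ proj₁)
  ∷ coordinate (toℕ ∘ proj₂)
  ∷ [])
  where
  open AdjacencyLists using (rows)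
  coordinate : ((Fin p × Fin r) × Fin m → ℕ) → List ℕ
  coordinate c = map (c ∘ _⊆ᴳ_.to G⊆) (allFin n)

Stores : Memory → Arr → List ℕ → Set
Stores s a xs = ∀ (i : Fin (length xs)) → arr s a (toℕ i) ≡ lookup xs i

-- The number of tracks is in register 0, the ordered lists of the tracks
-- in arrays 0 (positions) and 1 (concatenation).
record Holds {n t} {G : Graph (Fin n)} (s : Memory) (L : TrackLayout G t) : Set where
  open TrackLayout L
  field
    ordered  : ∀ i → List (Track i)
    sorted   : ∀ i → AllPairs _≺_ (ordered i)
    covers   : ∀ i (v : Track i) → v ∈ ordered i

  rows : List (List ℕ)
  rows = map (λ i → map (toℕ ∘ proj₁) (ordered i)) (allFin t)

  field
    count     : reg s 0 ≡ t
    positions : Stores s 0 (offsets rows)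
    contents  : Stores s 1 (concat rows)

-- Started in s, the program halts within T steps in a memory satisfying Q.
-- (Execution is deterministic.)
HaltsWithin : ∀ {ℓ} → Program → Memory → ℕ → (Memory → Set ℓ) → Set ℓ
HaltsWithin A s T Q = ∃[ s′ ] ∃[ k ] (A ⊢ s ⇓[ k ] s′ × k ≤ T × Q s′)

{-# OPTIONS --safe #-}
-- Write v ∈ V(G) as (i, k, w) with i a position on the path, k a vertex of K_r and w a vertex of H.
-- The track of v is (i mod 2h+1, k, track of w), ordered by i first and by the order of H second.
-- Two vertices of one track in different columns are more than 2h columns apart while an edge spans
-- at most h columns, so in an X-crossing u, u′ share a column and v, v′ share a column, and it would
-- project to an X-crossing of H.  The tracks are produced in linear time by three stable bucket
-- sorts: by the rank of w in the concatenated tracks of H, by i, and by the track.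
-- The RAM has no multiplication, so the track numbers are assembled from additively filled tables.
module Submission where

open import Defs
open import Data.Bool.Base using (Bool; false; _∨_; T)
open import Data.Empty using (⊥)
open import Data.Fin.Base as Fin using (Fin; toℕ; fromℕ<; combine)
open import Data.Fin.Properties as Fin
  using (toℕ-injective; toℕ-fromℕ<; toℕ<n; combine-injective; injective⇒≤)
open import Data.List.Base
  using (List; []; _∷_; _++_; map; length; lookup; concat; allFin; tabulate; filter; drop; replicate)
open import Data.List.Membership.Propositional using (_∈_)
open import Data.List.Membership.Propositional.Properties
  using (∈-lookup; ∈-filter⁺; ∈-map⁺; ∈-map⁻; ∈-concat⁺′; ∈-allFin)
open import Data.List.Properties
  using (length-map; length-++; length-tabulate; map-tabulate; map-∘; map-cong; concat-map)
open import Data.List.Relation.Unary.All as All using (All; []; _∷_)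
open import Data.List.Relation.Unary.All.Properties as All using (all-filter; tabulate⁺)
open import Data.List.Relation.Unary.AllPairs as AllPairs using (AllPairs; []; _∷_)
import Data.List.Relation.Unary.AllPairs.Properties as AllPairs
open import Data.List.Relation.Unary.Any using (index; here; there)
open import Data.List.Relation.Unary.Any.Properties using (lookup-index)
open import Data.List.Relation.Unary.Unique.Propositional using (Unique)
import Data.List.Relation.Unary.Unique.Propositional.Properties as Unique
open import Data.Nat.Base
  using (ℕ; zero; suc; _+_; _*_; _∸_; _≤_; _<_; z≤n; s≤s; _≡ᵇ_; NonZero; >-nonZero)
open import Data.Nat.DivMod
  using (_/_; _%_; _mod_; m≡m%n+[m/n]*n; m%n<n; m%n≤m; [m+kn]%n≡m%n; m<n⇒m%n≡m; n%n≡0)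
open import Data.Nat.Properties
open import Data.Nat.Solver using (module +-*-Solver)
open import Data.Product.Base using (Σ-syntax; ∃-syntax; _×_; _,_; proj₁; proj₂)
open import Data.Sum.Base using (_⊎_; inj₁; inj₂)
open import Data.Unit.Base using (⊤; tt)
open import Function.Base using (_∘_; id)
open import Level using (0ℓ)
open import Relation.Binary.Core using (Rel)
open import Relation.Binary.Definitions using (Trichotomous; tri<; tri≈; tri>)
open import Relation.Binary.PropositionalEquality
open import Relation.Binary.Structures using (IsStrictTotalOrder)
open import Relation.Binary.Structures.Biased using (isStrictTotalOrderᶜ)
open import Relation.Nullary using (yes; no; ¬_; contradiction)

-- Loop-free programs, frames and loops

-- The subroutine is an arbitrary program, while the machine has no procedure calls and fixes its
-- register and array names in the program text. It is therefore renamed injectively into a region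
-- of memory that shares with the decomposition only the places of `H`. Its cost is unchanged, and
-- the coordinates and the zeroed bucket heads survive whatever it does. The order inside the tracks
-- of `H` is abstract and invisible to the machine; all that can be computed is the position of a
-- vertex in the concatenated lists. `Ranking` isolates what such positions satisfy, and the layout
-- of `G` is defined from them, which separates the geometric argument from the proof about
-- programs. No loop contains another: a traversal of a list of lists is flattened into one loop
-- with a round per element and a round per list. Each loop then makes at most `K * X` rounds, with
-- `X = n + h * r * t + f t H` and `K` depending on `C` alone, so the constant of the theorem can be
-- computed from the program text.

update-same : ∀ {A : Set} (f : ℕ → A) k a → update f k a k ≡ a
update-same f k a with k ≟ k
... | yes _  = refl
... | no k≢k = contradiction refl k≢k

update-other : ∀ {A : Set} (f : ℕ → A) {k} a {j} → j ≢ k → update f k a j ≡ f j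
update-other f {k} a {j} j≢k with j ≟ k
... | yes j≡k = contradiction j≡k j≢k
... | no  _   = refl

-- Executed code yields updates whose indices are still register contents. Taking the update up to
-- `f≡` lets index and value be rewritten to known numbers before a cell is read.
module _ {A : Set} {f g : ℕ → A} {k a} (f≡ : f ≡ update g k a) where

  hit : ∀ {j} → j ≡ k → f j ≡ a
  hit refl = trans (cong (λ f → f k) f≡) (update-same g k a)

  miss : ∀ {j} → j ≢ k → f j ≡ g j
  miss {j} j≢k = trans (cong (λ f → f j) f≡) (update-other g a j≢k)

branch : {A : Set} → ℕ → A → A → A
branch zero    a b = b
branch (suc _) a b = a

-- The clause for `while` is a dummy, excluded by `LoopFree`. On concrete code `exec` unfolds by
-- computation, so the effect of a loop body needs no derivation in the big-step semantics.
exec : Program → Memory → Memory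
exec skip          s = s
exec (const x k)   s = setReg x k s
exec (add x y z)   s = setReg x (reg s y + reg s z) s
exec (sub x y z)   s = setReg x (reg s y ∸ reg s z) s
exec (load x a y)  s = setReg x (arr s a (reg s y)) s
exec (store a y z) s = setCell a (reg s y) (reg s z) s
exec (A ⨟ B)       s = exec B (exec A s)
exec (if x A B)    s = branch (reg s x) (exec A s) (exec B s)
exec (while _ _)   s = s

LoopFree : Program → Set
LoopFree (A ⨟ B)     = LoopFree A × LoopFree B
LoopFree (if _ A B)  = LoopFree A × LoopFree B
LoopFree (while _ _) = ⊥
LoopFree _           = ⊤

-- Both branches of a conditional are charged, which makes the bound independent of the memory.
size : Program → ℕ
size (A ⨟ B)    = size A + size B
size (if _ A B) = suc (size A + size B)
size (while _ A) = suc (size A)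
size _          = 1

1≤size : ∀ A → 1 ≤ size A
1≤size skip          = ≤-refl
1≤size (const _ _)   = ≤-refl
1≤size (add _ _ _)   = ≤-refl
1≤size (sub _ _ _)   = ≤-refl
1≤size (load _ _ _)  = ≤-refl
1≤size (store _ _ _) = ≤-refl
1≤size (A ⨟ B)       = ≤-trans (1≤size A) (m≤m+n _ _)
1≤size (if _ _ _)    = s≤s z≤n
1≤size (while _ _)   = s≤s z≤n

exec-⇓ : ∀ A {s} → LoopFree A → ∃[ k ] (A ⊢ s ⇓[ k ] exec A s × k ≤ size A)
exec-⇓ skip          _ = 1 , skip  , ≤-refl
exec-⇓ (const _ _)   _ = 1 , const , ≤-refl
exec-⇓ (add _ _ _)   _ = 1 , add   , ≤-refl
exec-⇓ (sub _ _ _)   _ = 1 , sub   , ≤-refl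
exec-⇓ (load _ _ _)  _ = 1 , load  , ≤-refl
exec-⇓ (store _ _ _) _ = 1 , store , ≤-refl
exec-⇓ (A ⨟ B) (a , b) with exec-⇓ A a | exec-⇓ B b
... | _ , A⇓ , p | _ , B⇓ , q = _ , seq A⇓ B⇓ , +-mono-≤ p q
exec-⇓ (if x A B) {s} (a , b) with reg s x in eq
... | zero with exec-⇓ B b
...   | _ , B⇓ , q = _ , if-false eq B⇓ , s≤s (m≤n⇒m≤o+n (size A) q)
exec-⇓ (if x A B) {s} (a , b) | suc _ with exec-⇓ A a
...   | _ , A⇓ , p =
  _ , if-true (λ e → 0≢1+n (trans (sym e) eq)) A⇓ , s≤s (m≤n⇒m≤n+o (size B) p)

-- Applied to the run of the subroutine, this makes the size of the instance positive, so that
-- additive constants can be absorbed even when `G` is empty.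
⇓-cost : ∀ {A s k s′} → A ⊢ s ⇓[ k ] s′ → 1 ≤ k
⇓-cost skip               = ≤-refl
⇓-cost const              = ≤-refl
⇓-cost add                = ≤-refl
⇓-cost sub                = ≤-refl
⇓-cost load               = ≤-refl
⇓-cost store              = ≤-refl
⇓-cost (seq A⇓ _)         = ≤-trans (⇓-cost A⇓) (m≤m+n _ _)
⇓-cost (if-true _ _)      = s≤s z≤n
⇓-cost (if-false _ _)     = s≤s z≤n
⇓-cost (while-true _ _ _) = s≤s z≤n
⇓-cost (while-false _)    = ≤-refl

-- A Boolean read off the program text, so that for concrete code a frame condition is closed by
-- `refl`.
writesReg : Program → Reg → Bool
writesReg (const x _)  z = z ≡ᵇ x
writesReg (add x _ _)  z = z ≡ᵇ x
writesReg (sub x _ _)  z = z ≡ᵇ x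
writesReg (load x _ _) z = z ≡ᵇ x
writesReg (A ⨟ B)      z = writesReg A z ∨ writesReg B z
writesReg (if _ A B)   z = writesReg A z ∨ writesReg B z
writesReg (while _ A)  z = writesReg A z
writesReg _            z = false

writesArr : Program → Arr → Bool
writesArr (store a _ _) b = b ≡ᵇ a
writesArr (A ⨟ B)       b = writesArr A b ∨ writesArr B b
writesArr (if _ A B)    b = writesArr A b ∨ writesArr B b
writesArr (while _ A)   b = writesArr A b
writesArr _             b = false

∨-falseˡ : ∀ x {y} → x ∨ y ≡ false → x ≡ false
∨-falseˡ false _ = refl

∨-falseʳ : ∀ x {y} → x ∨ y ≡ false → y ≡ false
∨-falseʳ false e = e

≡ᵇ-false : ∀ {m n} → (m ≡ᵇ n) ≡ false → m ≢ n
≡ᵇ-false {m} e refl = subst T e (≡⇒≡ᵇ m m refl)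

private
  unset : ∀ x k s z → (z ≡ᵇ x) ≡ false → reg (setReg x k s) z ≡ reg s z
  unset x k s z e = update-other (reg s) k (≡ᵇ-false {z} {x} e)

unwrittenReg : ∀ {A s k s′} z → A ⊢ s ⇓[ k ] s′ → writesReg A z ≡ false →
               reg s′ z ≡ reg s z
unwrittenReg z skip  _ = refl
unwrittenReg {s = s} z (const {x = x}) e = unset x _ s z e
unwrittenReg {s = s} z (add {x = x})   e = unset x _ s z e
unwrittenReg {s = s} z (sub {x = x})   e = unset x _ s z e
unwrittenReg {s = s} z (load {x = x})  e = unset x _ s z e
unwrittenReg z store _ = refl
unwrittenReg {A ⨟ B} z (seq A⇓ B⇓) e =
  trans (unwrittenReg z B⇓ (∨-falseʳ (writesReg A z) e))
        (unwrittenReg z A⇓ (∨-falseˡ (writesReg A z) e))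
unwrittenReg {if _ A _} z (if-true _ A⇓) e  = unwrittenReg z A⇓ (∨-falseˡ (writesReg A z) e)
unwrittenReg {if _ A _} z (if-false _ B⇓) e = unwrittenReg z B⇓ (∨-falseʳ (writesReg A z) e)
unwrittenReg z (while-true _ A⇓ W⇓) e =
  trans (unwrittenReg z W⇓ e) (unwrittenReg z A⇓ e)
unwrittenReg z (while-false _) _ = refl

unwrittenArr : ∀ {A s k s′} b → A ⊢ s ⇓[ k ] s′ → writesArr A b ≡ false →
               arr s′ b ≡ arr s b
unwrittenArr b skip  _ = refl
unwrittenArr b const _ = refl
unwrittenArr b add   _ = refl
unwrittenArr b sub   _ = refl
unwrittenArr b load  _ = refl
unwrittenArr {store a _ _} {s} b store e = update-other (arr s) _ (≡ᵇ-false {b} {a} e)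
unwrittenArr {A ⨟ B} b (seq A⇓ B⇓) e =
  trans (unwrittenArr b B⇓ (∨-falseʳ (writesArr A b) e))
        (unwrittenArr b A⇓ (∨-falseˡ (writesArr A b) e))
unwrittenArr {if _ A _} b (if-true _ A⇓) e  = unwrittenArr b A⇓ (∨-falseˡ (writesArr A b) e)
unwrittenArr {if _ A _} b (if-false _ B⇓) e = unwrittenArr b B⇓ (∨-falseʳ (writesArr A b) e)
unwrittenArr b (while-true _ A⇓ W⇓) e =
  trans (unwrittenArr b W⇓ e) (unwrittenArr b A⇓ e)
unwrittenArr b (while-false _) _ = refl

record Frame (A : Program) (s s′ : Memory) : Set where
  field
    regs : ∀ z → writesReg A z ≡ false → reg s′ z ≡ reg s z
    arrs : ∀ b → writesArr A b ≡ false → arr s′ b ≡ arr s b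
open Frame public

module _ {ℓ} {Q : Memory → Set ℓ} where

  framed : ∀ {A s T} → HaltsWithin A s T Q → HaltsWithin A s T (λ s′ → Q s′ × Frame A s s′)
  framed (s′ , k , A⇓ , k≤T , q) = s′ , k , A⇓ , k≤T , q , record
    { regs = λ z → unwrittenReg z A⇓ ; arrs = λ b → unwrittenArr b A⇓ }

  halts-weaken : ∀ {A s T T′} → T ≤ T′ → HaltsWithin A s T Q → HaltsWithin A s T′ Q
  halts-weaken T≤T′ (s′ , k , A⇓ , k≤T , q) = s′ , k , A⇓ , ≤-trans k≤T T≤T′ , q

  halts-map : ∀ {ℓ′} {R : Memory → Set ℓ′} {A s T} → HaltsWithin A s T R →
              (∀ {s′} → R s′ → Q s′) → HaltsWithin A s T Q
  halts-map (s′ , k , A⇓ , k≤T , r) f = s′ , k , A⇓ , k≤T , f r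

  halts-exec : ∀ A {s} → LoopFree A → Q (exec A s) → HaltsWithin A s (size A) Q
  halts-exec A free q with exec-⇓ A free
  ... | k , A⇓ , k≤ = _ , k , A⇓ , k≤ , q

  loop-end : ∀ {x A s} → reg s x ≡ 0 → Q s → HaltsWithin (while x A) s 1 Q
  loop-end e q = _ , 1 , while-false e , ≤-refl , q

  loop-step : ∀ {x A s s′ k T} → reg s x ≡ suc k → LoopFree A → exec A s ≡ s′ →
              HaltsWithin (while x A) s′ T Q →
              HaltsWithin (while x A) s (suc (size A + T)) Q
  loop-step {A = A} {s} e free refl (s″ , l , W⇓ , l≤ , q) with exec-⇓ A {s} free
  ... | k , A⇓ , k≤ =
    s″ , _ , while-true (λ z → 0≢1+n (trans (sym z) e)) A⇓ W⇓ , s≤s (+-mono-≤ k≤ l≤) , q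

  -- Linear time in the size X of the instance, so that phases compose by adding constants.
  module _ (X : ℕ) where

    halts-seq : ∀ {ℓ′} {R : Memory → Set ℓ′} {A B s} a b →
                HaltsWithin A s (a * X) R → (∀ {s′} → R s′ → HaltsWithin B s′ (b * X) Q) →
                HaltsWithin (A ⨟ B) s ((a + b) * X) Q
    halts-seq a b (s′ , k , A⇓ , k≤ , r) next with next r
    ... | s″ , l , B⇓ , l≤ , q =
      s″ , k + l , seq A⇓ B⇓ ,
      ≤-trans (+-mono-≤ k≤ l≤) (≤-reflexive (sym (*-distribʳ-+ X a b))) , q

loopTime : ℕ → Program → ℕ
loopTime zero    A = 1
loopTime (suc k) A = suc (size A + loopTime k A)

-- The invariant is indexed by the rounds still to be made, which the register `x` must contain;
-- termination and running time both come from this index.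
halts-loop : ∀ {ℓ} {Q : Memory → Set ℓ} (I : ℕ → Memory → Set ℓ) x A → LoopFree A →
             (∀ {k s} → I k s → reg s x ≡ k) →
             (∀ {k s} → I (suc k) s → I k (exec A s)) →
             (∀ {s} → I 0 s → Q s) →
             ∀ k {s} → I k s → HaltsWithin (while x A) s (loopTime k A) Q
halts-loop I x A free counter step end zero    i = loop-end (counter i) (end i)
halts-loop I x A free counter step end (suc k) i =
  loop-step (counter i) free refl (halts-loop I x A free counter step end k (step i))

loopTime-* : ∀ k A → loopTime k A ≡ k * suc (size A) + 1
loopTime-* zero    A = refl
loopTime-* (suc k) A =
  cong suc (trans (cong (size A +_) (loopTime-* k A)) (sym (+-assoc (size A) _ 1)))

loopTime-linear : ∀ {X} c {k} A → 1 ≤ X → k ≤ c * X →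
                  loopTime k A ≤ (c * suc (size A) + 1) * X
loopTime-linear {X} c {k} A 1≤X k≤ = begin
  loopTime k A                     ≡⟨ loopTime-* k A ⟩
  k * suc (size A) + 1             ≤⟨ +-mono-≤ (*-monoˡ-≤ (suc (size A)) k≤) 1≤X ⟩
  c * X * suc (size A) + X         ≡⟨ cong (_+ X) (*-assoc c X _) ⟩
  c * (X * suc (size A)) + X       ≡⟨ cong (λ z → c * z + X) (*-comm X _) ⟩
  c * (suc (size A) * X) + X       ≡⟨ cong₂ _+_ (sym (*-assoc c _ X)) (sym (+-identityʳ X)) ⟩
  c * suc (size A) * X + 1 * X     ≡⟨ *-distribʳ-+ X (c * suc (size A)) 1 ⟨
  (c * suc (size A) + 1) * X       ∎
  where open ≤-Reasoning

size-linear : ∀ {X} A → 1 ≤ X → size A ≤ size A * X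
size-linear {X} A 1≤X = ≤-trans (≤-reflexive (sym (*-identityʳ _))) (*-monoʳ-≤ (size A) 1≤X)

-- Renaming

module _ (ρ α : ℕ → ℕ) where

  rename : Program → Program
  rename skip          = skip
  rename (const x k)   = const (ρ x) k
  rename (add x y z)   = add (ρ x) (ρ y) (ρ z)
  rename (sub x y z)   = sub (ρ x) (ρ y) (ρ z)
  rename (load x a y)  = load (ρ x) (α a) (ρ y)
  rename (store a y z) = store (α a) (ρ y) (ρ z)
  rename (A ⨟ B)       = rename A ⨟ rename B
  rename (if x A B)    = if (ρ x) (rename A) (rename B)
  rename (while x A)   = while (ρ x) (rename A)

  -- Only names in the images of `ρ` and `α` are compared, so the larger memory may hold anything
  -- elsewhere.
  record Simulates (s⁺ s : Memory) : Set where
    constructor sim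
    field
      regs≡ : ∀ x → reg s⁺ (ρ x) ≡ reg s x
      arrs≡ : ∀ a i → arr s⁺ (α a) i ≡ arr s a i
  open Simulates public

  -- This protects the registers outside the image of `ρ` from a subroutine about which nothing else
  -- is known.
  rename-¬writesReg : ∀ A z → (∀ x → (z ≡ᵇ ρ x) ≡ false) → writesReg (rename A) z ≡ false
  rename-¬writesReg skip          z ∉ = refl
  rename-¬writesReg (const x _)   z ∉ = ∉ x
  rename-¬writesReg (add x _ _)   z ∉ = ∉ x
  rename-¬writesReg (sub x _ _)   z ∉ = ∉ x
  rename-¬writesReg (load x _ _)  z ∉ = ∉ x
  rename-¬writesReg (store _ _ _) z ∉ = refl
  rename-¬writesReg (A ⨟ B)       z ∉ =
    cong₂ _∨_ (rename-¬writesReg A z ∉) (rename-¬writesReg B z ∉)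
  rename-¬writesReg (if _ A B)    z ∉ =
    cong₂ _∨_ (rename-¬writesReg A z ∉) (rename-¬writesReg B z ∉)
  rename-¬writesReg (while _ A)   z ∉ = rename-¬writesReg A z ∉

  rename-¬writesArr : ∀ A b → (∀ a → (b ≡ᵇ α a) ≡ false) → writesArr (rename A) b ≡ false
  rename-¬writesArr skip          b ∉ = refl
  rename-¬writesArr (const _ _)   b ∉ = refl
  rename-¬writesArr (add _ _ _)   b ∉ = refl
  rename-¬writesArr (sub _ _ _)   b ∉ = refl
  rename-¬writesArr (load _ _ _)  b ∉ = refl
  rename-¬writesArr (store a _ _) b ∉ = ∉ a
  rename-¬writesArr (A ⨟ B)       b ∉ =
    cong₂ _∨_ (rename-¬writesArr A b ∉) (rename-¬writesArr B b ∉)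
  rename-¬writesArr (if _ A B)    b ∉ =
    cong₂ _∨_ (rename-¬writesArr A b ∉) (rename-¬writesArr B b ∉)
  rename-¬writesArr (while _ A)   b ∉ = rename-¬writesArr A b ∉

  module _ (ρ-inj : ∀ {x y} → ρ x ≡ ρ y → x ≡ y) (α-inj : ∀ {a b} → α a ≡ α b → a ≡ b) where

    private
      sim-setReg : ∀ {s⁺ s k⁺ k} x → Simulates s⁺ s → k⁺ ≡ k →
                   Simulates (setReg (ρ x) k⁺ s⁺) (setReg x k s)
      sim-setReg {s⁺} {s} {k} x r refl = sim regs′ (arrs≡ r)
        where
        regs′ : ∀ y → update (reg s⁺) (ρ x) k (ρ y) ≡ update (reg s) x k y
        regs′ y with y ≟ x
        ... | yes refl = update-same (reg s⁺) (ρ x) k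
        ... | no y≢x   = trans (update-other (reg s⁺) k (λ e → y≢x (ρ-inj e))) (regs≡ r y)

      sim-setCell : ∀ {s⁺ s i⁺ i k⁺ k} a → Simulates s⁺ s → i⁺ ≡ i → k⁺ ≡ k →
                    Simulates (setCell (α a) i⁺ k⁺ s⁺) (setCell a i k s)
      sim-setCell {s⁺} {s} {i} {k = k} a r refl refl = sim (regs≡ r) arrs′
        where
        row : ∀ j → update (arr s⁺ (α a)) i k j ≡ update (arr s a) i k j
        row j with j ≟ i
        ... | yes _ = refl
        ... | no  _ = arrs≡ r a j
        arrs′ : ∀ b j → update (arr s⁺) (α a) (update (arr s⁺ (α a)) i k) (α b) j
                     ≡ update (arr s) a (update (arr s a) i k) b j
        arrs′ b j with b ≟ a
        ... | yes refl = trans (cong (λ g → g j) (update-same (arr s⁺) (α a) _)) (row j)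
        ... | no b≢a   =
          trans (cong (λ g → g j) (update-other (arr s⁺) _ (λ e → b≢a (α-inj e)))) (arrs≡ r b j)

    -- Injectivity ensures that a write through one renamed name does not clobber another. Tests and
    -- operands then see equal values, so the run takes the same course in the same number of steps.
    rename-⇓ : ∀ {A s k s′ s⁺} → A ⊢ s ⇓[ k ] s′ → Simulates s⁺ s →
               ∃[ s⁺′ ] (rename A ⊢ s⁺ ⇓[ k ] s⁺′ × Simulates s⁺′ s′)
    rename-⇓ skip r = _ , skip , r
    rename-⇓ (const {x = x}) r = _ , const , sim-setReg x r refl
    rename-⇓ (add {x = x} {y} {z}) r = _ , add , sim-setReg x r (cong₂ _+_ (regs≡ r y) (regs≡ r z))
    rename-⇓ (sub {x = x} {y} {z}) r = _ , sub , sim-setReg x r (cong₂ _∸_ (regs≡ r y) (regs≡ r z))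
    rename-⇓ {s = s} {s⁺ = s⁺} (load {x = x} {a} {y}) r =
      _ , load , sim-setReg x r (trans (cong (arr s⁺ (α a)) (regs≡ r y)) (arrs≡ r a _))
    rename-⇓ (store {a = a} {y} {z}) r = _ , store , sim-setCell a r (regs≡ r y) (regs≡ r z)
    rename-⇓ (seq A⇓ B⇓) r =
      let _ , A⁺ , r′ = rename-⇓ A⇓ r
          _ , B⁺ , r″ = rename-⇓ B⇓ r′
      in _ , seq A⁺ B⁺ , r″
    rename-⇓ (if-true {x} ≢0 A⇓) r =
      let _ , A⁺ , r′ = rename-⇓ A⇓ r
      in _ , if-true (λ e → ≢0 (trans (sym (regs≡ r x)) e)) A⁺ , r′
    rename-⇓ (if-false {x} ≡0 B⇓) r =
      let _ , B⁺ , r′ = rename-⇓ B⇓ r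
      in _ , if-false (trans (regs≡ r x) ≡0) B⁺ , r′
    rename-⇓ (while-true {x} ≢0 A⇓ W⇓) r =
      let _ , A⁺ , r′ = rename-⇓ A⇓ r
          _ , W⁺ , r″ = rename-⇓ W⇓ r′
      in _ , while-true (λ e → ≢0 (trans (sym (regs≡ r x)) e)) A⁺ W⁺ , r″
    rename-⇓ (while-false {x} ≡0) r = _ , while-false (trans (regs≡ r x) ≡0) , r

-- Enumerations

AllPairs-lookup : ∀ {A : Set} {R : Rel A 0ℓ} {xs} → AllPairs R xs →
                  ∀ {i j} → i Fin.< j → R (lookup xs i) (lookup xs j)
AllPairs-lookup (px ∷ pxs) {Fin.zero}  {Fin.suc j} _         = All.lookup px (∈-lookup j)
AllPairs-lookup (px ∷ pxs) {Fin.suc i} {Fin.suc j} (s≤s i<j) = AllPairs-lookup pxs i<j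

AllPairs-refine : ∀ {A : Set} {P : A → Set} {R S : Rel A 0ℓ} →
                  (∀ {x y} → P x → P y → R x y → S x y) →
                  ∀ {xs} → All P xs → AllPairs R xs → AllPairs S xs
AllPairs-refine f []       []         = []
AllPairs-refine {P = P} f (p ∷ ps) (rs ∷ rss) = row p ps rs ∷ AllPairs-refine f ps rss
  where
  row : ∀ {x} → P x → ∀ {ys} → All P ys → All _ ys → All _ ys
  row p []       []       = []
  row p (q ∷ qs) (r ∷ rs) = f p q r ∷ row p qs rs

lookup-injective : ∀ {A : Set} {xs : List A} → Unique xs →
                   ∀ {i j} → lookup xs i ≡ lookup xs j → i ≡ j
lookup-injective unique {i} {j} eq with Fin.<-cmp i j
... | tri< i<j _ _ = contradiction eq (AllPairs-lookup unique i<j)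
... | tri≈ _ i≡j _ = i≡j
... | tri> _ _ j<i = contradiction (sym eq) (AllPairs-lookup unique j<i)

module _ {n} {xs : List (Fin n)} where

  unique⇒length≤ : Unique xs → length xs ≤ n
  unique⇒length≤ unique = injective⇒≤ (lookup-injective unique)

  complete⇒≤length : (∀ v → v ∈ xs) → n ≤ length xs
  complete⇒≤length ∈xs = injective⇒≤ {f = λ v → index (∈xs v)} λ {u} {v} eq →
    trans (lookup-index (∈xs u)) (trans (cong (lookup xs) eq) (sym (lookup-index (∈xs v))))

-- Stable bucket sort

Lex : ∀ {V : Set} {B} → (V → Fin B) → Rel V 0ℓ → Rel V 0ℓ
Lex key R u v = key u Fin.< key v ⊎ (key u ≡ key v × R u v)

module _ {V : Set} {B} (key : V → Fin B) where

  bucket : List V → Fin B → List V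
  bucket xs b = filter (λ v → key v Fin.≟ b) xs

  buckets : List V → List (List V)
  buckets xs = map (bucket xs) (allFin B)

  bucketSort : List V → List V
  bucketSort xs = concat (buckets xs)

  ∈-bucket : ∀ {v xs} → v ∈ xs → v ∈ bucket xs (key v)
  ∈-bucket {v} v∈ = ∈-filter⁺ (λ u → key u Fin.≟ key v) v∈ refl

  ∈-bucketSort : ∀ {v xs} → v ∈ xs → v ∈ bucketSort xs
  ∈-bucketSort {v} {xs} v∈ = ∈-concat⁺′ (∈-bucket v∈) (∈-map⁺ (bucket xs) (∈-allFin (key v)))

  -- Stability: filtering keeps the order inside a bucket, and across buckets the keys already
  -- differ in the right direction.
  bucketSort-sorted : ∀ {R : Rel V 0ℓ} {xs} → AllPairs R xs → AllPairs (Lex key R) (bucketSort xs)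
  bucketSort-sorted {R} {xs} rs = AllPairs.concat⁺
    (All.map⁺ (tabulate⁺ λ b → AllPairs-refine (λ { refl q r → inj₂ (sym q , r) })
                                   (all-filter (λ v → key v Fin.≟ b) xs)
                                   (AllPairs.filter⁺ (λ v → key v Fin.≟ b) rs)))
    (AllPairs.map⁺ (AllPairs.tabulate⁺-< λ {b} {b′} b<b′ →
      All.map (λ { refl → All.map (λ { refl → inj₁ b<b′ })
                                  (all-filter (λ v → key v Fin.≟ b′) xs) })
              (all-filter (λ v → key v Fin.≟ b) xs)))

-- Ranked track layouts

module _ {m t} {H : Graph (Fin m)} (L : TrackLayout H t) where
  open TrackLayout L

  infix 4 _⊏_
  -- `≺` compares members of one `Track`. This carries it over to bare vertices, the track being
  -- that of the smaller vertex.
  _⊏_ : Rel (Fin m) 0ℓ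
  u ⊏ v = Σ[ e ∈ track v ≡ track u ] (u , refl) ≺ (v , e)

  ≺⇒⊏ : ∀ {i} {u v : Track i} → u ≺ v → proj₁ u ⊏ proj₁ v
  ≺⇒⊏ {u = _ , refl} {_ , e} u≺v = e , u≺v

  ⊏-irrefl : ∀ {u v} → u ≡ v → ¬ u ⊏ v
  ⊏-irrefl {u} refl (refl , u≺u) = irrefl refl u≺u
    where open IsStrictTotalOrder (isStrictTotalOrder (track u)) using (irrefl)

  -- All that the layout of `G` takes from the lists in memory. One direction between the orders
  -- suffices: a crossing is found in terms of ranks and transferred to `≺`.
  record Ranking (ℓ : ℕ) : Set where
    field
      rank           : Fin m → Fin ℓ
      rank-injective : ∀ {u v} → rank u ≡ rank v → u ≡ v
      rank-order     : ∀ {u v} → track u ≡ track v → rank u Fin.< rank v → u ⊏ v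

  module _ {s} (holds : Holds s L) where
    open Holds holds

    line : List (Fin m)
    line = concat (map (λ i → map proj₁ (ordered i)) (allFin t))

    private
      _⊑_ : Rel (Fin m) 0ℓ
      u ⊑ v = track u Fin.< track v ⊎ u ⊏ v

      line-sorted : AllPairs _⊑_ line
      line-sorted = AllPairs.concat⁺
        (All.map⁺ (tabulate⁺ λ i → AllPairs.map⁺ (AllPairs.map (inj₂ ∘ ≺⇒⊏) (sorted i))))
        (AllPairs.map⁺ (AllPairs.tabulate⁺-< λ {i} {j} i<j →
          All.map⁺ (All.universal (λ (_ , ui) →
            All.map⁺ (All.universal (λ (_ , vj) →
              inj₁ (subst₂ Fin._<_ (sym ui) (sym vj) i<j)) (ordered j))) (ordered i))))

    line-unique : Unique line
    line-unique = AllPairs.map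
      (λ { (inj₁ u<v) refl → Fin.<-irrefl refl u<v ; (inj₂ u⊏v) u≡v → ⊏-irrefl u≡v u⊏v })
      line-sorted

    ∈-line : ∀ v → v ∈ line
    ∈-line v = ∈-concat⁺′ (∈-map⁺ proj₁ (covers (track v) (v , refl)))
                          (∈-map⁺ (λ i → map proj₁ (ordered i)) (∈-allFin (track v)))

    private
      rank : Fin m → Fin (length line)
      rank v = index (∈-line v)

      lookup-rank : ∀ v → lookup line (rank v) ≡ v
      lookup-rank v = sym (lookup-index (∈-line v))

    ranking : Ranking (length line)
    ranking = record
      { rank           = rank
      ; rank-injective = λ {u} {v} e →
          trans (sym (lookup-rank u)) (trans (cong (lookup line) e) (lookup-rank v))
      ; rank-order     = λ {u} {v} e u<v →
          case-⊑ e (subst₂ _⊑_ (lookup-rank u) (lookup-rank v) (AllPairs-lookup line-sorted u<v))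
      }
      where
      case-⊑ : ∀ {u v} → track u ≡ track v → u ⊑ v → u ⊏ v
      case-⊑ e (inj₁ u<v) = contradiction u<v (Fin.<-irrefl e)
      case-⊑ e (inj₂ u⊏v) = u⊏v

    -- `rank` comes from one chosen membership proof; since `line` has no duplicates, no other
    -- position was possible. This identifies the positions met by the program with ranks.
    rank-lookup : ∀ k → rank (lookup line k) ≡ k
    rank-lookup k = lookup-injective line-unique (lookup-rank (lookup line k))

-- Strong product with a power of a path

module _ {p : ℕ} where

  walk-upper : ∀ {d x y} → Walk (path p) d x y → toℕ y ≤ toℕ x + d
  walk-upper nil = m≤m+n _ 0
  walk-upper (cons {d} {x} {y} a w) = ≤-trans (walk-upper w)
    (≤-trans (+-monoˡ-≤ d (bound a)) (≤-reflexive (sym (+-suc (toℕ x) d))))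
    where
    bound : Graph.Adj (path p) x y → toℕ y ≤ suc (toℕ x)
    bound (inj₁ e) = ≤-reflexive (sym e)
    bound (inj₂ e) = m≤n⇒m≤1+n (≤-trans (n≤1+n _) (≤-reflexive e))

  walk-lower : ∀ {d x y} → Walk (path p) d x y → toℕ x ≤ toℕ y + d
  walk-lower nil = m≤m+n _ 0
  walk-lower (cons {d} {x} {y} {z} a w) = ≤-trans (bound a)
    (≤-trans (s≤s (walk-lower w)) (≤-reflexive (sym (+-suc (toℕ z) d))))
    where
    bound : Graph.Adj (path p) x y → toℕ x ≤ suc (toℕ y)
    bound (inj₁ e) = m≤n⇒m≤1+n (≤-trans (n≤1+n _) (≤-reflexive e))
    bound (inj₂ e) = ≤-reflexive (sym e)

-- Equal residues leave only the quotients to differ. If the quotient of `a` is the smaller one, `b`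
-- gains a full `d`; otherwise `b` could not exceed `a`.
%-spread : ∀ {a b} d .{{_ : NonZero d}} → a % d ≡ b % d → a < b → a + d ≤ b
%-spread {a} {b} d eq a<b with a / d <? b / d
... | yes q<q′ = begin
  a + d                       ≡⟨ cong (_+ d) (m≡m%n+[m/n]*n a d) ⟩
  a % d + a / d * d + d       ≡⟨ +-assoc (a % d) _ d ⟩
  a % d + (a / d * d + d)     ≡⟨ cong₂ _+_ eq (+-comm _ d) ⟩
  b % d + suc (a / d) * d     ≤⟨ +-monoʳ-≤ (b % d) (*-monoˡ-≤ d q<q′) ⟩
  b % d + b / d * d           ≡⟨ m≡m%n+[m/n]*n b d ⟨
  b                           ∎
  where open ≤-Reasoning
... | no q≮q′ = contradiction a<b (≤⇒≯ (begin
  b                           ≡⟨ m≡m%n+[m/n]*n b d ⟩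
  b % d + b / d * d           ≤⟨ +-mono-≤ (≤-reflexive (sym eq)) (*-monoˡ-≤ d (≮⇒≥ q≮q′)) ⟩
  a % d + a / d * d           ≡⟨ m≡m%n+[m/n]*n a d ⟨
  a                           ∎))
  where open ≤-Reasoning

-- The composite track layout

period : ℕ → ℕ
period h = 2 * h + 1

period-nonZero : ∀ h → NonZero (period h)
period-nonZero h = >-nonZero (≤-trans (s≤s z≤n) (≤-reflexive (+-comm 1 (2 * h))))

module Composite {n p m h r t ℓ} {H : Graph (Fin m)} {G : Graph (Fin n)}
                 (G⊆ : G ⊆ᴳ path p ^ᴳ h ⊠ complete r ⊠ H)
                 (L : TrackLayout H t) (R : Ranking L ℓ) where

  private
    module G = Graph G
    module H = Graph H
    module L = TrackLayout L
    instance
      period≢0 : NonZero (period h)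
      period≢0 = period-nonZero h
  open _⊆ᴳ_ G⊆
  open Ranking R

  column : Fin n → Fin p
  column = proj₁ ∘ proj₁ ∘ to

  layer : Fin n → Fin r
  layer = proj₂ ∘ proj₁ ∘ to

  base : Fin n → Fin m
  base = proj₂ ∘ to

  residue : Fin n → Fin (period h)
  residue v = toℕ (column v) mod period h

  toℕ-residue : ∀ v → toℕ (residue v) ≡ toℕ (column v) % period h
  toℕ-residue v = toℕ-fromℕ< (m%n<n (toℕ (column v)) (period h))

  trackOf : Fin n → Fin (period h * r * t)
  trackOf v = combine (combine (residue v) (layer v)) (L.track (base v))

  -- The mixed-radix form of `combine`. Multiplied out, it is a sum of three terms that depend on
  -- one coordinate each, hence of three table entries.
  toℕ-trackOf : ∀ v → toℕ (trackOf v) ≡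
    t * (r * (toℕ (column v) % period h) + toℕ (layer v)) + toℕ (L.track (base v))
  toℕ-trackOf v = trans (Fin.toℕ-combine (combine (residue v) (layer v)) (L.track (base v)))
    (cong (λ z → t * z + toℕ (L.track (base v)))
      (trans (Fin.toℕ-combine (residue v) (layer v))
        (cong (λ z → r * z + toℕ (layer v)) (toℕ-residue v))))

  -- Defined on all vertices, but total only inside a track, where the layers agree and column and
  -- rank therefore determine the vertex.
  Before : Rel (Fin n) 0ℓ
  Before = Lex column (λ u v → rank (base u) Fin.< rank (base v))

  private
    coordinates-injective : ∀ {u v} → column u ≡ column v → layer u ≡ layer v →
                            base u ≡ base v → u ≡ v
    coordinates-injective e f g = injective (cong₂ _,_ (cong₂ _,_ e f) g)

    trackOf-injective : ∀ {u v} → trackOf u ≡ trackOf v →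
      (toℕ (column u) % period h ≡ toℕ (column v) % period h × layer u ≡ layer v)
      × L.track (base u) ≡ L.track (base v)
    trackOf-injective {u} {v} e
      with e′ , base≡  ← combine-injective (combine (residue u) (layer u)) (L.track (base u))
                                           (combine (residue v) (layer v)) (L.track (base v)) e
      with e″ , layer≡ ← combine-injective (residue u) (layer u) (residue v) (layer v) e′
      = (trans (sym (toℕ-residue u)) (trans (cong toℕ e″) (toℕ-residue v)) , layer≡) , base≡

    track-column : ∀ {u v} → trackOf u ≡ trackOf v → column u Fin.< column v →
                   toℕ (column u) + (h + h) < toℕ (column v)
    track-column {u} {v} e u<v = ≤-trans
      (≤-reflexive (trans (sym (+-suc _ (h + h))) (cong (toℕ (column u) +_)
        (trans (+-comm 1 (h + h)) (cong (λ z → h + z + 1) (sym (+-identityʳ h)))))))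
      (%-spread (period h) (proj₁ (proj₁ (trackOf-injective e))) u<v)

    adjacent-column : ∀ {u v} → G.Adj u v → toℕ (column v) ≤ toℕ (column u) + h
    adjacent-column uv with preserves uv
    ... | inj₁ (e , _) = ≤-trans (≤-reflexive (cong (toℕ ∘ proj₁) (sym e))) (m≤m+n _ h)
    ... | inj₂ (inj₁ (_ , inj₁ (e , _))) = ≤-trans (≤-reflexive (cong toℕ (sym e))) (m≤m+n _ h)
    ... | inj₂ (inj₁ (_ , inj₂ (inj₁ (_ , _ , _ , (w , _) , d≤h)))) =
      ≤-trans (walk-upper w) (+-monoʳ-≤ _ d≤h)
    ... | inj₂ (inj₁ (_ , inj₂ (inj₂ ((_ , _ , (w , _) , d≤h) , _)))) =
      ≤-trans (walk-upper w) (+-monoʳ-≤ _ d≤h)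
    ... | inj₂ (inj₂ (inj₁ (e , _) , _)) = ≤-trans (≤-reflexive (cong toℕ (sym e))) (m≤m+n _ h)
    ... | inj₂ (inj₂ (inj₂ (inj₁ (_ , _ , _ , (w , _) , d≤h)) , _)) =
      ≤-trans (walk-upper w) (+-monoʳ-≤ _ d≤h)
    ... | inj₂ (inj₂ (inj₂ (inj₂ ((_ , _ , (w , _) , d≤h) , _)) , _)) =
      ≤-trans (walk-upper w) (+-monoʳ-≤ _ d≤h)

    adjacent-base : ∀ {u v} → G.Adj u v → base u ≡ base v ⊎ H.Adj (base u) (base v)
    adjacent-base uv with preserves uv
    ... | inj₁ (_ , e)        = inj₂ e
    ... | inj₂ (inj₁ (e , _)) = inj₁ e
    ... | inj₂ (inj₂ (_ , e)) = inj₂ e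

    -- Equal tracks exclude a step in `H` and a step in the complete graph. What remains is an edge
    -- along the path alone; its ends lie in distinct congruent columns, more than `2 * h` apart.
    independent : ∀ {u v} → trackOf u ≡ trackOf v → ¬ G.Adj u v
    independent {u} {v} e uv with trackOf-injective {u} {v} e
    ... | (_ , layer≡) , base-track≡ with preserves uv
    ... | inj₁ (_ , a)                        = L.independent base-track≡ a
    ... | inj₂ (inj₂ (_ , a))                 = L.independent base-track≡ a
    ... | inj₂ (inj₁ (_ , inj₁ (_ , a)))      = a layer≡
    ... | inj₂ (inj₁ (_ , inj₂ (inj₂ (_ , a)))) = a layer≡
    ... | inj₂ (inj₁ (_ , inj₂ (inj₁ (_ , ≢ , _)))) with Fin.<-cmp (column u) (column v)
    ...   | tri< u<v _ _ = <⇒≱ (track-column e u<v)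
              (≤-trans (adjacent-column uv) (+-monoʳ-≤ _ (m≤m+n h h)))
    ...   | tri≈ _ u≡v _ = ≢ u≡v
    ...   | tri> _ _ v<u = <⇒≱ (track-column (sym e) v<u)
              (≤-trans (adjacent-column (G.symmetric uv)) (+-monoʳ-≤ _ (m≤m+n h h)))

    -- An edge of `G` may collapse to a vertex of `H`. If both edges collapse, the two rank
    -- inequalities contradict each other; if one does, all four vertices lie on one track and the
    -- other edge violates independence.
    noBaseCrossing : ∀ {u u′ v v′} → L.track u ≡ L.track u′ → L.track v ≡ L.track v′ →
                     u ≡ v ⊎ H.Adj u v → u′ ≡ v′ ⊎ H.Adj u′ v′ →
                     rank u Fin.< rank u′ → rank v′ Fin.< rank v → ⊥
    noBaseCrossing e f (inj₁ refl) (inj₁ refl) u<u′ v′<v = Fin.<-asym u<u′ v′<v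
    noBaseCrossing e f (inj₁ refl) (inj₂ u′v′) _ _ = L.independent (trans (sym e) f) u′v′
    noBaseCrossing e f (inj₂ uv) (inj₁ refl)   _ _ = L.independent (trans e (sym f)) uv
    noBaseCrossing {u} {u′} {v} {v′} e f (inj₂ uv) (inj₂ u′v′) u<u′ v′<v
      with e₁ , u≺u′ ← rank-order e u<u′ | e₂ , v′≺v ← rank-order (sym f) v′<v
      = L.noXCrossing record
        { i≢j = λ i≡j → L.independent (trans i≡j e₂′) uv
        ; u = u , refl ; u′ = u′ , e₁ ; v = v , e₂ ; v′ = v′ , refl
        ; uv = uv ; u′v′ = u′v′ ; u≺u′ = u≺u′ ; v′≺v = v′≺v }
      where e₂′ = sym f

    Before-trans : ∀ {u v w} → Before u v → Before v w → Before u w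
    Before-trans (inj₁ a)       (inj₁ b)       = inj₁ (Fin.<-trans a b)
    Before-trans {u} (inj₁ a)   (inj₂ (e , _)) = inj₁ (subst (column u Fin.<_) e a)
    Before-trans {w = w} (inj₂ (e , _)) (inj₁ b) = inj₁ (subst (Fin._< column w) (sym e) b)
    Before-trans (inj₂ (e , a)) (inj₂ (f , b)) = inj₂ (trans e f , Fin.<-trans a b)

    Before-irrefl : ∀ {u} → ¬ Before u u
    Before-irrefl (inj₁ a)       = Fin.<-irrefl refl a
    Before-irrefl (inj₂ (_ , a)) = Fin.<-irrefl refl a

    Before-total : ∀ {u v} → trackOf u ≡ trackOf v → u ≢ v → Before u v ⊎ Before v u
    Before-total {u} {v} e u≢v with Fin.<-cmp (column u) (column v)
    ... | tri< a _ _ = inj₁ (inj₁ a)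
    ... | tri> _ _ a = inj₂ (inj₁ a)
    ... | tri≈ _ c≡ _ with Fin.<-cmp (rank (base u)) (rank (base v))
    ...   | tri< a _ _ = inj₁ (inj₂ (c≡ , a))
    ...   | tri> _ _ a = inj₂ (inj₂ (sym c≡ , a))
    ...   | tri≈ _ r≡ _ = contradiction
            (coordinates-injective c≡ (proj₂ (proj₁ (trackOf-injective {u} {v} e)))
                                   (rank-injective r≡)) u≢v

  -- Sorting starts from a list known only to be free of duplicates, hence the `≢` in the last
  -- place. Ties in column and rank can occur between different layers, but not within one track.
  Before-refine : ∀ {u v} → trackOf u ≡ trackOf v →
                  Lex column (Lex (rank ∘ base) _≢_) u v → Before u v
  Before-refine e (inj₁ a)                    = inj₁ a
  Before-refine e (inj₂ (c≡ , inj₁ a))        = inj₂ (c≡ , a)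
  Before-refine {u} {v} e (inj₂ (c≡ , inj₂ (r≡ , u≢v))) = contradiction
    (coordinates-injective c≡ (proj₂ (proj₁ (trackOf-injective {u} {v} e))) (rank-injective r≡)) u≢v

  layout : TrackLayout G (period h * r * t)
  layout = record
    { assignment = record
      { track              = trackOf
      ; independent        = independent
      ; _≺_                = λ u v → Before (proj₁ u) (proj₁ v)
      ; isStrictTotalOrder = λ i → isStrictTotalOrderᶜ record
        { isEquivalence = isEquivalence
        ; trans         = Before-trans
        ; compare       = compare i
        }
      }
    ; noXCrossing = λ c → let open TrackAssignment.XCrossing c in
        crossing (trans (proj₂ u) (sym (proj₂ u′))) (trans (proj₂ v) (sym (proj₂ v′)))
                 uv u′v′ u≺u′ v′≺v
    }
    where

    compare : ∀ i → Trichotomous _≡_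
                (λ (u v : Σ[ v ∈ Fin n ] trackOf v ≡ i) → Before (proj₁ u) (proj₁ v))
    compare i (u , d) (v , e) with u Fin.≟ v
    compare i (u , refl) (u , refl) | yes refl = tri≈ Before-irrefl refl Before-irrefl
    ... | no  u≢v with Before-total {u} {v} (trans d (sym e)) u≢v
    ...   | inj₁ a = tri< a (λ q → u≢v (cong proj₁ q)) (λ b → Before-irrefl (Before-trans a b))
    ...   | inj₂ a = tri> (λ b → Before-irrefl (Before-trans a b)) (λ q → u≢v (cong proj₁ q)) a

    -- The route from `a` to `d` through the other pair uses two edges and does not advance in
    -- between, so it cannot bridge a gap above `2 * h`.
    far : ∀ {a b c d} → a + (h + h) < d → d ≤ c + h → c ≤ b → b ≤ a + h → ⊥
    far {a} {b} {c} {d} a≪d d≤c c≤b b≤a = <⇒≱ a≪d (begin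
      d              ≤⟨ d≤c ⟩
      c + h          ≤⟨ +-monoˡ-≤ h (≤-trans c≤b b≤a) ⟩
      a + h + h      ≡⟨ +-assoc a h h ⟩
      a + (h + h)    ∎)
      where open ≤-Reasoning

    crossing : ∀ {u u′ v v′} → trackOf u ≡ trackOf u′ → trackOf v ≡ trackOf v′ →
               G.Adj u v → G.Adj u′ v′ → Before u u′ → Before v′ v → ⊥
    crossing {u} {u′} e f uv u′v′ (inj₁ u<u′) v′≺v =
      far (track-column e u<u′) (adjacent-column (G.symmetric u′v′)) (weak v′≺v) (adjacent-column uv)
      where
      weak : ∀ {x y} → Before x y → toℕ (column x) ≤ toℕ (column y)
      weak (inj₁ a)       = <⇒≤ a
      weak (inj₂ (c≡ , _)) = ≤-reflexive (cong toℕ c≡)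
    crossing e f uv u′v′ (inj₂ (c≡ , _)) (inj₁ v′<v) =
      far (track-column (sym f) v′<v) (adjacent-column uv)
          (≤-reflexive (cong toℕ c≡)) (adjacent-column (G.symmetric u′v′))
    crossing {u} {u′} {v} {v′} e f uv u′v′ (inj₂ (_ , u<u′)) (inj₂ (_ , v′<v)) =
      noBaseCrossing (proj₂ (trackOf-injective {u} {u′} e)) (proj₂ (trackOf-injective {v} {v′} f))
                     (adjacent-base uv) (adjacent-base u′v′) u<u′ v′<v

-- Running time of programs without nested loops

budget : ℕ → Program → ℕ
budget K (A ⨟ B)     = budget K A + budget K B
budget K (if _ A B)  = suc (budget K A + budget K B)
-- The body is charged by `size`, as it is meant to be loop-free. The summand 1 pays for the failing
-- last test.
budget K (while _ A) = K * suc (size A) + 1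
budget K _           = 1

budget-loopFree : ∀ K A → LoopFree A → size A ≡ budget K A
budget-loopFree K skip          _ = refl
budget-loopFree K (const _ _)   _ = refl
budget-loopFree K (add _ _ _)   _ = refl
budget-loopFree K (sub _ _ _)   _ = refl
budget-loopFree K (load _ _ _)  _ = refl
budget-loopFree K (store _ _ _) _ = refl
budget-loopFree K (A ⨟ B) (a , b) = cong₂ _+_ (budget-loopFree K A a) (budget-loopFree K B b)
budget-loopFree K (if _ A B) (a , b) =
  cong suc (cong₂ _+_ (budget-loopFree K A a) (budget-loopFree K B b))

exec-frame : ∀ A {s} → LoopFree A → Frame A s (exec A s)
exec-frame A {s} free with exec-⇓ A {s} free
... | _ , A⇓ , _ = record
  { regs = λ z → unwrittenReg z A⇓ ; arrs = λ b → unwrittenArr b A⇓ }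

frame-seq : ∀ {A B s s′ s″} → Frame A s s′ → Frame B s′ s″ → Frame (A ⨟ B) s s″
frame-seq {A} f g = record
  { regs = λ z e → trans (regs g z (∨-falseʳ (writesReg A z) e)) (regs f z (∨-falseˡ (writesReg A z) e))
  ; arrs = λ b e → trans (arrs g b (∨-falseʳ (writesArr A b) e)) (arrs f b (∨-falseˡ (writesArr A b) e))
  }

-- Every loop is run at most K X times, so a program without nested loops takes budget K A * X steps.
module Linear (K X : ℕ) (1≤X : 1 ≤ X) where

  Within : ∀ {ℓ} → Program → Memory → (Memory → Set ℓ) → Set ℓ
  Within A s Q = HaltsWithin A s (budget K A * X) Q

  within-loopFree : ∀ {ℓ} {Q : Memory → Set ℓ} A {s} → LoopFree A → Q (exec A s) → Within A s Q
  within-loopFree A free q = halts-weaken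
    (≤-trans (size-linear A 1≤X) (*-monoˡ-≤ X (≤-reflexive (budget-loopFree K A free))))
    (halts-exec A free q)

  within-seq : ∀ {ℓ ℓ′} {R : Memory → Set ℓ′} {Q : Memory → Set ℓ} {A B s} →
               Within A s R → (∀ {s′} → Frame A s s′ → R s′ → Within B s′ Q) → Within (A ⨟ B) s Q
  within-seq {A = A} {B} w next =
    halts-seq X (budget K A) (budget K B) (framed w) (λ (r , f) → next f r)

  within-exec : ∀ {ℓ} {Q : Memory → Set ℓ} A {B s} → LoopFree A →
                Within B (exec A s) Q → Within (A ⨟ B) s Q
  within-exec A {s = s} free w = within-seq {R = λ s′ → s′ ≡ exec A s}
    (within-loopFree A free refl) λ { _ refl → w }

  within-loopTime : ∀ {ℓ} {Q : Memory → Set ℓ} {x A s} k → k ≤ K * X →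
                    HaltsWithin (while x A) s (loopTime k A) Q → Within (while x A) s Q
  within-loopTime {A = A} k k≤ = halts-weaken (loopTime-linear K A 1≤X k≤)

  within-map : ∀ {ℓ ℓ′} {Q : Memory → Set ℓ} {R : Memory → Set ℓ′} {A s} → Within A s Q →
               (∀ {s′} → Frame A s s′ → Q s′ → R s′) → Within A s R
  within-map w f with framed w
  ... | s′ , k , A⇓ , k≤ , q , fr = s′ , k , A⇓ , k≤ , f fr q

-- Lists in memory

-- A recursive form of `Stores` with a start position, so that an induction along a loop can peel
-- off one cell at a time.
Stored : (ℕ → ℕ) → ℕ → List ℕ → Set
Stored f o []       = ⊤
Stored f o (x ∷ xs) = f o ≡ x × Stored f (suc o) xs

stored-lookup : ∀ {f} o xs → Stored f o xs → ∀ (i : Fin (length xs)) → f (o + toℕ i) ≡ lookup xs i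
stored-lookup {f} o (x ∷ xs) (e , _) Fin.zero    = trans (cong f (+-identityʳ o)) e
stored-lookup {f} o (x ∷ xs) (_ , r) (Fin.suc i) =
  trans (cong f (+-suc o (toℕ i))) (stored-lookup (suc o) xs r i)

lookup-stored : ∀ {f} o xs → (∀ (i : Fin (length xs)) → f (o + toℕ i) ≡ lookup xs i) → Stored f o xs
lookup-stored     o []       h = tt
lookup-stored {f} o (x ∷ xs) h =
  trans (cong f (sym (+-identityʳ o))) (h Fin.zero) ,
  lookup-stored (suc o) xs λ i → trans (cong f (sym (+-suc o (toℕ i)))) (h (Fin.suc i))

stored-cong : ∀ {f g} o xs → (∀ i → f i ≡ g i) → Stored g o xs → Stored f o xs
stored-cong o []       e _       = tt
stored-cong o (x ∷ xs) e (a , r) = trans (e o) a , stored-cong (suc o) xs e r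

stored-offset : ∀ {f o k} xss → Stored f o (offsetsFrom k xss) → f o ≡ k
stored-offset []      (e , _) = e
stored-offset (_ ∷ _) (e , _) = e

drop-uncons : ∀ {n f} k (xs : List (Fin n)) o → k < length xs → Stored f o (map toℕ xs) →
              ∃[ x ] (drop k xs ≡ x ∷ drop (suc k) xs × f (o + k) ≡ toℕ x)
drop-uncons {f = f} zero (x ∷ xs) o _ (e , _) = x , refl , trans (cong f (+-identityʳ o)) e
drop-uncons {f = f} (suc k) (x ∷ xs) o (s≤s k<) (_ , r) with drop-uncons k xs (suc o) k< r
... | y , d , e = y , d , trans (cong f (+-suc o k)) e

drop-all : ∀ {A : Set} (xs : List A) → drop (length xs) xs ≡ []
drop-all []       = refl
drop-all (x ∷ xs) = drop-all xs

-- Node h of a linked list has value vl h and successor nx h; the null pointer is 0.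
Chain : (nx vl : ℕ → ℕ) → ℕ → ℕ → List ℕ → Set
Chain nx vl k h []       = h ≡ 0
Chain nx vl k h (x ∷ xs) = ∃[ h′ ] (h ≡ suc h′ × k ≤ h′ × vl h ≡ x × Chain nx vl k (nx h) xs)

-- All nodes of an existing chain have numbers above `suc k`, so the node `suc k` is fresh and
-- writing it leaves the chain intact.
chain-update : ∀ {nx vl k a b h} xs → Chain nx vl (suc k) h xs →
               Chain (update nx (suc k) a) (update vl (suc k) b) k h xs
chain-update []       e = e
chain-update {nx} {vl} {k} {a} {b} {h} (x ∷ xs) (h′ , e , k<h′ , v , c) =
  h′ , e , <⇒≤ k<h′ , trans (update-other vl b h≢) v ,
  subst (λ z → Chain _ _ k z xs) (sym (update-other nx a h≢)) (chain-update xs c)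
  where
  h≢ : h ≢ suc k
  h≢ h≡ = <⇒≢ k<h′ (suc-injective (trans (sym h≡) e))

Chains : (nx vl hd : ℕ → ℕ) → ℕ → List (List ℕ) → Set
Chains nx vl hd j []         = ⊤
Chains nx vl hd j (xs ∷ xss) = Chain nx vl 0 (hd j) xs × Chains nx vl hd (suc j) xss

chains-cong : ∀ {nx vl hd hd′} j xss → (∀ i → j ≤ i → hd′ i ≡ hd i) →
              Chains nx vl hd j xss → Chains nx vl hd′ j xss
chains-cong j []         e _       = tt
chains-cong j (xs ∷ xss) e (c , r) =
  subst (λ z → Chain _ _ 0 z xs) (sym (e j ≤-refl)) c ,
  chains-cong (suc j) xss (λ i j<i → e i (<⇒≤ j<i)) r

chains-tabulate : ∀ {nx vl hd B} j (f : Fin B → List ℕ) →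
                  (∀ b → Chain nx vl 0 (hd (j + toℕ b)) (f b)) → Chains nx vl hd j (tabulate f)
chains-tabulate {B = zero}  j f c = tt
chains-tabulate {nx} {vl} {hd} {B = suc B} j f c =
  subst (λ z → Chain nx vl 0 (hd z) (f Fin.zero)) (+-identityʳ j) (c Fin.zero) ,
  chains-tabulate (suc j) (f ∘ Fin.suc) λ b →
    subst (λ z → Chain nx vl 0 (hd z) (f (Fin.suc b))) (+-suc j (toℕ b)) (c (Fin.suc b))

-- Memory map

-- Registers 0 to 4 and arrays 0 to 6 are dictated by the input format. Register 1 holds `m` until
-- the subroutine replaces it by `t`; likewise arrays 2 and 3 hold first the adjacency lists of `H`
-- and then its tracks. Arrays 0 and 1 are reused for the output.
$n $t $p $h $r $w $s $τ $ℓ $1 $c $0 $i $j $o $a $b $d $size : Reg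
$n = 0
$t = 1
$p = 2
$h = 3
$r = 4
$w = 5
$s = 6
$τ = 7
$ℓ = 8
$1 = 9
$c = 10
$0 = 11
$i = 12
$j = 13
$o = 14
$a = 15
$b = 16
$d = 17
$size = 18

#start #seq #offset #line #column #layer #base #rank #track #mod #shift #key #head #next #value : Arr
#start  = 0
#seq    = 1
#offset = 2
#line   = 3
#column = 4
#layer  = 5
#base   = 6
#rank   = 7
#track  = 8
#mod    = 9
#shift  = 10
#key    = 11
#head   = 12
#next   = 13
#value  = 14

-- The sequence is pushed from its end, so each bucket is popped in the order of the sequence.  A round
-- of emit pops one item or moves on to the next bucket, so the number of rounds is known beforehand.
push pop advance emit : Program
push =
  sub $i $c $1 ⨟ load $d #seq $i ⨟ load $b #key $d ⨟ load $a #head $b ⨟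
  store #next $c $a ⨟ store #value $c $d ⨟ store #head $b $c ⨟ sub $c $c $1
pop =
  load $d #value $a ⨟ store #seq $o $d ⨟ add $o $o $1 ⨟ load $a #next $a ⨟ store #head $j $a
advance = add $j $j $1 ⨟ store #start $j $o
emit = load $a #head $j ⨟ if $a pop advance ⨟ sub $c $c $1

sortByKey : Program
sortByKey =
  add $c $n $0 ⨟ while $c push ⨟
  (const $j 0 ⨟ const $o 0 ⨟ store #start $j $o ⨟ add $c $n $size) ⨟ while $c emit

-- With `k` pushes left, the items from position `k` on are in the buckets. `null` covers the heads
-- beyond the `B` buckets: the next sort, with another number of buckets, needs the whole array to
-- be zero again.
record Pushed {n B} (key : Fin n → Fin B) (xs : List (Fin n)) (k : ℕ) (s : Memory) : Set where
  field
    counter : reg s $c ≡ k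
    unit    : reg s $1 ≡ 1
    bound   : k ≤ length xs
    stored  : Stored (arr s #seq) 0 (map toℕ xs)
    keys    : ∀ v → arr s #key (toℕ v) ≡ toℕ (key v)
    chains  : ∀ b → Chain (arr s #next) (arr s #value) k (arr s #head (toℕ b))
                          (map toℕ (bucket key (drop k xs) b))
    null    : ∀ i → B ≤ i → arr s #head i ≡ 0

push-step : ∀ {n B} {key : Fin n → Fin B} {xs k s} →
            Pushed key xs (suc k) s → Pushed key xs k (exec push s)
push-step {n} {B} {key} {xs} {k} {s} I with drop-uncons k xs 0 (Pushed.bound I) (Pushed.stored I)
... | x , drop≡ , seq≡ = record
  { counter = previous
  ; unit    = unit
  ; bound   = <⇒≤ bound
  ; stored  = stored
  ; keys    = keys
  ; chains  = λ b → subst (λ ys → Chain _ _ k _ (map toℕ (bucket key ys b))) (sym drop≡) (chain b)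
  ; null    = λ i B≤i → trans
                (miss head≡ (λ e → <⇒≢ (<-≤-trans (Fin.toℕ<n (key x)) B≤i) (sym e)))
                (null i B≤i)
  }
  where
  open Pushed I
  s′ = exec push s

  previous : reg s $c ∸ reg s $1 ≡ k
  previous = cong₂ _∸_ counter unit

  value≡x : arr s #seq (reg s $c ∸ reg s $1) ≡ toℕ x
  value≡x = trans (cong (arr s #seq) previous) seq≡

  key≡ : arr s #key (arr s #seq (reg s $c ∸ reg s $1)) ≡ toℕ (key x)
  key≡ = trans (cong (arr s #key) value≡x) (keys x)

  head≡ : arr s′ #head ≡ update (arr s #head) (toℕ (key x)) (suc k)
  head≡ = cong₂ (update (arr s #head)) key≡ counter

  next≡ : arr s′ #next ≡ update (arr s #next) (suc k) (arr s #head (toℕ (key x)))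
  next≡ = cong₂ (update (arr s #next)) counter (cong (arr s #head) key≡)

  value≡ : arr s′ #value ≡ update (arr s #value) (suc k) (toℕ x)
  value≡ = cong₂ (update (arr s #value)) counter value≡x

  old : ∀ b → Chain (arr s′ #next) (arr s′ #value) k (arr s #head (toℕ b))
                    (map toℕ (bucket key (drop (suc k) xs) b))
  old b = subst₂ (λ f g → Chain f g k (arr s #head (toℕ b)) (map toℕ (bucket key (drop (suc k) xs) b)))
                 (sym next≡) (sym value≡) (chain-update _ (chains b))

  chain : ∀ b → Chain (arr s′ #next) (arr s′ #value) k (arr s′ #head (toℕ b))
                      (map toℕ (bucket key (x ∷ drop (suc k) xs) b))
  chain b with key x Fin.≟ b
  ... | yes refl = k , head-here , ≤-refl ,
          hit value≡ head-here ,
          subst (λ z → Chain _ _ k z (map toℕ (bucket key (drop (suc k) xs) (key x))))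
                (sym (hit next≡ head-here))
                (old (key x))
    where
    head-here : arr s′ #head (toℕ (key x)) ≡ suc k
    head-here = hit head≡ refl
  ... | no key≢ =
          subst (λ z → Chain _ _ k z (map toℕ (bucket key (drop (suc k) xs) b)))
                (sym (miss head≡ (λ e → key≢ (sym (toℕ-injective e)))))
                (old b)

-- The rounds of the flattened loop: one per element and one per list for moving on.
emissions : List (List ℕ) → ℕ
emissions []         = 0
emissions (xs ∷ xss) = suc (length xs) + emissions xss

emissions≡ : ∀ xss → emissions xss ≡ length (concat xss) + length xss
emissions≡ []         = refl
emissions≡ (xs ∷ xss) = begin
  suc (length xs + emissions xss)                        ≡⟨ cong (λ z → suc (length xs + z)) (emissions≡ xss) ⟩
  suc (length xs + (length (concat xss) + length xss))   ≡⟨ cong suc (+-assoc (length xs) _ _) ⟨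
  suc (length xs + length (concat xss) + length xss)     ≡⟨ +-suc _ _ ⟨
  length xs + length (concat xss) + suc (length xss)     ≡⟨ cong (_+ _) (length-++ xs) ⟨
  length (xs ++ concat xss) + suc (length xss)           ∎
  where open ≡-Reasoning

record Emitting (s : Memory) (j o k : ℕ) : Set where
  field
    counter : reg s $c ≡ k
    unit    : reg s $1 ≡ 1
    row     : reg s $j ≡ j
    out     : reg s $o ≡ o

-- `before` and `earlier` protect what previous rounds have written. `start` is a parameter because
-- inside a row the offsets still to be described begin one row later than between rows.
record Emitted (s s′ : Memory) (j o : ℕ) (start : Set) (xs : List ℕ) : Set where
  field
    starts  : start
    before  : ∀ i → i < j → arr s′ #start i ≡ arr s #start i
    content : Stored (arr s′ #seq) o xs
    earlier : ∀ i → i < o → arr s′ #seq i ≡ arr s #seq i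
    null    : ∀ i → arr s′ #head i ≡ 0

branch-suc : ∀ {A : Set} {k x} {a b : A} → k ≡ suc x → branch k a b ≡ a
branch-suc refl = refl

branch-zero : ∀ {A : Set} {k} {a b : A} → k ≡ 0 → branch k a b ≡ b
branch-zero refl = refl

mutual
  -- Here `xs` is the unread rest of bucket `j`, whereas `emitRows` stands at the beginning of a
  -- bucket. The condition that all heads outside the pending rows vanish grows, bucket by bucket,
  -- into an entirely zero array of heads.
  emitRow : ∀ xs xss {j o s} → Emitting s j o (suc (length xs) + emissions xss) →
            Chain (arr s #next) (arr s #value) 0 (arr s #head j) xs →
            Chains (arr s #next) (arr s #value) (arr s #head) (suc j) xss →
            (∀ i → i < j ⊎ suc j + length xss ≤ i → arr s #head i ≡ 0) →
            HaltsWithin (while $c emit) s (loopTime (suc (length xs) + emissions xss) emit)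
              (λ s′ → Emitted s s′ (suc j) o
                        (Stored (arr s′ #start) (suc j) (offsetsFrom (o + length xs) xss))
                        (xs ++ concat xss))
  emitRow [] xss {j} {o} {s} I empty cs null =
    -- The test is decided only up to an equation, so the conditional is replaced by its branch
    -- underneath the rest of the round, the decrement of `$c`.
    loop-step counter _ (cong (exec (sub $c $c $1)) (branch-zero (trans (cong (arr s #head) row) empty)))
      (halts-map (emitRows xss record
          { counter = cong₂ _∸_ counter unit ; unit = unit ; row = row′ ; out = out }
          (hit start≡ refl)
          cs null′)
        λ {s′} e → let open Emitted e in record
          { starts  = subst (λ z → Stored (arr s′ #start) (suc j) (offsetsFrom z xss)) (sym (+-identityʳ o)) starts
          ; before  = λ i i<j → trans (before i (m<n⇒m<1+n i<j)) (miss start≡ (<⇒≢ i<j))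
          ; content = content
          ; earlier = earlier
          ; null    = Emitted.null e
          })
    where
    open Emitting I
    row′ : reg s $j + reg s $1 ≡ suc j
    row′ = trans (cong₂ _+_ row unit) (+-comm j 1)
    start≡ : update (arr s #start) (reg s $j + reg s $1) (reg s $o) ≡ update (arr s #start) (suc j) o
    start≡ = cong₂ (update (arr s #start)) row′ out
    null′ : ∀ i → i < suc j ⊎ suc j + length xss ≤ i → arr s #head i ≡ 0
    null′ i (inj₂ i≥) = null i (inj₂ i≥)
    null′ i (inj₁ (s≤s i≤j)) with m≤n⇒m<n∨m≡n i≤j
    ... | inj₁ i<j  = null i (inj₁ i<j)
    ... | inj₂ refl = empty
  emitRow (x ∷ xs) xss {j} {o} {s} I (h′ , h≡ , _ , v≡ , c) cs null =
    loop-step counter _ (cong (exec (sub $c $c $1)) (branch-suc (trans (cong (arr s #head) row) h≡)))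
      (halts-map (emitRow xs xss record
          { counter = cong₂ _∸_ counter unit ; unit = unit ; row = row
          ; out = trans (cong₂ _+_ out unit) (+-comm o 1) }
          (subst (λ z → Chain _ _ 0 z xs)
            (sym (hit head≡ refl)) c)
          (chains-cong (suc j) xss (λ i j<i → miss head≡ (λ e → <⇒≢ j<i (sym e))) cs)
          (λ i i∉ → trans (miss head≡ (outside i∉)) (null i i∉)))
        λ {s′} e → let open Emitted e in record
          { starts  = subst (λ z → Stored (arr s′ #start) (suc j) (offsetsFrom z xss)) (sym (+-suc o (length xs))) starts
          ; before  = before
          ; content = trans (earlier o ≤-refl) (hit seq≡ refl) , content
          ; earlier = λ i i<o → trans (earlier i (m<n⇒m<1+n i<o)) (miss seq≡ (<⇒≢ i<o))
          ; null    = Emitted.null e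
          })
    where
    open Emitting I
    h = arr s #head (reg s $j)
    h≡j : h ≡ arr s #head j
    h≡j = cong (arr s #head) row
    head≡ : update (arr s #head) (reg s $j) (arr s #next h)
          ≡ update (arr s #head) j (arr s #next (arr s #head j))
    head≡ = cong₂ (update (arr s #head)) row (cong (arr s #next) h≡j)
    seq≡ : update (arr s #seq) (reg s $o) (arr s #value h) ≡ update (arr s #seq) o x
    seq≡ = cong₂ (update (arr s #seq)) out (trans (cong (arr s #value) h≡j) v≡)
    outside : ∀ {i} → i < j ⊎ suc j + length xss ≤ i → i ≢ j
    outside (inj₁ i<j) = <⇒≢ i<j
    outside (inj₂ j<i) e = <⇒≢ (≤-trans (m≤m+n (suc j) _) j<i) (sym e)

  emitRows : ∀ xss {j o s} → Emitting s j o (emissions xss) → arr s #start j ≡ o →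
             Chains (arr s #next) (arr s #value) (arr s #head) j xss →
             (∀ i → i < j ⊎ j + length xss ≤ i → arr s #head i ≡ 0) →
             HaltsWithin (while $c emit) s (loopTime (emissions xss) emit)
               (λ s′ → Emitted s s′ (suc j) o (Stored (arr s′ #start) j (offsetsFrom o xss)) (concat xss))
  emitRows [] {j} I start _ null = loop-end (Emitting.counter I) record
    { starts  = start , tt
    ; before  = λ _ _ → refl
    ; content = tt
    ; earlier = λ _ _ → refl
    ; null    = λ i → null i (covered i)
    }
    where
    covered : ∀ i → i < j ⊎ j + 0 ≤ i
    covered i with i <? j
    ... | yes i<j = inj₁ i<j
    ... | no  i≮j = inj₂ (≤-trans (≤-reflexive (+-identityʳ j)) (≮⇒≥ i≮j))
  emitRows (xs ∷ xss) {j} I start (c , cs) null =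
    halts-map (emitRow xs xss I c cs (λ i i∉ → null i (shift i∉)))
      λ e → let open Emitted e in record
        { starts  = trans (before j ≤-refl) start , starts
        ; before  = before
        ; content = content
        ; earlier = earlier
        ; null    = Emitted.null e
        }
    where
    shift : ∀ {i} → i < j ⊎ suc j + length xss ≤ i → i < j ⊎ j + suc (length xss) ≤ i
    shift (inj₁ i<j) = inj₁ i<j
    shift (inj₂ i≥)  = inj₂ (≤-trans (≤-reflexive (+-suc j _)) i≥)

-- Successive sorts by tabulated keys

IsEnumeration : ∀ {n} → List (Fin n) → Set
IsEnumeration xs = Unique xs × (∀ v → v ∈ xs)

enumeration-length : ∀ {n} {xs : List (Fin n)} → IsEnumeration xs → length xs ≡ n
enumeration-length (unique , complete) =
  ≤-antisym (unique⇒length≤ unique) (complete⇒≤length complete)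

-- `Unique` is `AllPairs` of `≢`, so it passes through the sort in the role of the initial order.
bucketSort-enumeration : ∀ {n B} (key : Fin n → Fin B) {xs} →
                         IsEnumeration xs → IsEnumeration (bucketSort key xs)
bucketSort-enumeration key (unique , complete) =
  AllPairs.map (λ { (inj₁ u<v) refl → Fin.<-irrefl refl u<v ; (inj₂ (_ , u≢v)) → u≢v })
               (bucketSort-sorted key unique) ,
  λ v → ∈-bucketSort key (complete v)

rowsOf : ∀ {n B} → (Fin n → Fin B) → List (Fin n) → List (List ℕ)
rowsOf {B = B} key xs = map (λ b → map toℕ (bucket key xs b)) (allFin B)

concat-rowsOf : ∀ {n B} (key : Fin n → Fin B) xs →
                concat (rowsOf key xs) ≡ map toℕ (bucketSort key xs)
concat-rowsOf {B = B} key xs = trans (cong concat (map-∘ (allFin B))) (concat-map (buckets key xs))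

record Arranged {n} (xs : List (Fin n)) (s : Memory) : Set where
  field
    stored : Stored (arr s #seq) 0 (map toℕ xs)
    null   : ∀ i → arr s #head i ≡ 0

record Sorted {n B} (key : Fin n → Fin B) (xs : List (Fin n)) (s : Memory) : Set where
  field
    arranged : Arranged (bucketSort key xs) s
    starts   : Stored (arr s #start) 0 (offsets (rowsOf key xs))

record Prepared {n ℓ p τ} (rank : Fin n → Fin ℓ) (column : Fin n → Fin p) (track : Fin n → Fin τ)
                (s : Memory) : Set where
  field
    n≡      : reg s $n ≡ n
    p≡      : reg s $p ≡ p
    τ≡      : reg s $τ ≡ τ
    ℓ≡      : reg s $ℓ ≡ ℓ
    unit    : reg s $1 ≡ 1
    zero≡   : reg s $0 ≡ 0
    ranks   : ∀ v → arr s #rank (arr s #base (toℕ v)) ≡ toℕ (rank v)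
    columns : ∀ v → arr s #column (toℕ v) ≡ toℕ (column v)
    tracks  : ∀ v → arr s #mod (arr s #column (toℕ v)) + arr s #shift (arr s #layer (toℕ v))
                    + arr s #track (arr s #base (toℕ v)) ≡ toℕ (track v)

-- Written as two equations between lists of Booleans, so that a concrete program needs just
-- `refl , refl`.
Keeps : Program → Set
Keeps A = map (writesReg A) ($n ∷ $p ∷ $τ ∷ $ℓ ∷ $1 ∷ $0 ∷ []) ≡ replicate 6 false
        × map (writesArr A) (#rank ∷ #base ∷ #column ∷ #mod ∷ #shift ∷ #layer ∷ #track ∷ [])
          ≡ replicate 7 false

prepared-frame : ∀ {n ℓ p τ} {rank : Fin n → Fin ℓ} {column : Fin n → Fin p} {track : Fin n → Fin τ}
                   {A s s′} → Keeps A → Frame A s s′ →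
                 Prepared rank column track s → Prepared rank column track s′
prepared-frame {track = track} {A} {s} {s′} (kr , ka) f P = record
  { n≡      = trans (regs f $n (bit kr 0)) n≡
  ; p≡      = trans (regs f $p (bit kr 1)) p≡
  ; τ≡      = trans (regs f $τ (bit kr 2)) τ≡
  ; ℓ≡      = trans (regs f $ℓ (bit kr 3)) ℓ≡
  ; unit    = trans (regs f $1 (bit kr 4)) unit
  ; zero≡   = trans (regs f $0 (bit kr 5)) zero≡
  ; ranks   = λ v → trans (cong₂ (λ g h → g (h (toℕ v))) rank≡ base≡) (ranks v)
  ; columns = λ v → trans (cong (λ g → g (toℕ v)) column≡) (columns v)
  ; tracks  = λ v → trans (cong₂ _+_ (cong₂ _+_ (cong₂ (λ g h → g (h (toℕ v))) mod≡ column≡)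
                                                (cong₂ (λ g h → g (h (toℕ v))) shift≡ layer≡))
                                     (cong₂ (λ g h → g (h (toℕ v))) track≡ base≡))
                          (tracks v)
  }
  where
  open Prepared P
  bit : ∀ {xs ys} → xs ≡ ys → ∀ i → at false xs i ≡ at false ys i
  bit e i = cong (λ l → at false l i) e
  rank≡   = arrs f #rank   (bit ka 0)
  base≡   = arrs f #base   (bit ka 1)
  column≡ = arrs f #column (bit ka 2)
  mod≡    = arrs f #mod    (bit ka 3)
  shift≡  = arrs f #shift  (bit ka 4)
  layer≡  = arrs f #layer  (bit ka 5)
  track≡  = arrs f #track  (bit ka 6)

-- The keys are tabulated before each sort, so that a single sorting program serves all three
-- passes.
fill : Program → Program
fill compute = sub $c $c $1 ⨟ compute ⨟ store #key $c $a

round : Program → Reg → Program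
round compute B = add $c $n $0 ⨟ while $c (fill compute) ⨟ add $size B $0 ⨟ sortByKey

rankKey columnKey trackKey : Program
rankKey   = load $a #base $c ⨟ load $a #rank $a
columnKey = load $a #column $c
trackKey  =
  load $a #column $c ⨟ load $a #mod $a ⨟ load $b #layer $c ⨟ load $b #shift $b ⨟ add $a $a $b ⨟
  load $b #base $c ⨟ load $b #track $b ⨟ add $a $a $b

sorting : Program
-- Register 0, which held `n`, must finally contain the number of tracks.
sorting = round rankKey $ℓ ⨟ round columnKey $p ⨟ round trackKey $τ ⨟ add $n $τ $0

module Sorting (K X : ℕ) (1≤X : 1 ≤ X) where
  open Linear K X 1≤X

  sortByKey-within : ∀ {n B} (key : Fin n → Fin B) {xs s} → IsEnumeration xs → n + B ≤ K * X →
    reg s $n ≡ n → reg s $size ≡ B → reg s $1 ≡ 1 → reg s $0 ≡ 0 → Arranged xs s →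
    (∀ v → arr s #key (toℕ v) ≡ toℕ (key v)) → Within sortByKey s (Sorted key xs)
  sortByKey-within {n} {B} key {xs} {s} enum n+B≤ n≡ B≡ unit zero≡ arranged keys =
    within-exec (add $c $n $0) _
      (within-seq
        (within-loopTime n (≤-trans (m≤m+n n B) n+B≤)
          (halts-loop (Pushed key xs) $c push _ Pushed.counter push-step id n pushed))
        λ {s₁} f I → let
            unit₁ = Pushed.unit I
            n≡₁ = trans (regs f $n refl) n≡
            B≡₁ = trans (regs f $size refl) B≡
          in within-exec (const $j 0 ⨟ const $o 0 ⨟ store #start $j $o ⨟ add $c $n $size) _
            (within-loopTime (emissions (rowsOf key xs)) (≤-trans (≤-reflexive emissions≡n+B) n+B≤)
              (halts-map (emitRows (rowsOf key xs) record
                  { counter = trans (cong₂ _+_ n≡₁ B≡₁) (sym emissions≡n+B)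
                  ; unit = unit₁ ; row = refl ; out = refl }
                  refl
                  (subst (Chains (arr s₁ #next) (arr s₁ #value) (arr s₁ #head) 0)
                    (sym (map-tabulate id (λ b → map toℕ (bucket key xs b))))
                    (chains-tabulate 0 _ (Pushed.chains I)))
                  λ { _ (inj₁ ()) ; i (inj₂ i≥) → Pushed.null I i
                        (≤-trans (≤-reflexive (sym length-rows)) i≥) })
                λ {s′} e → record
                  { arranged = record
                    { stored = subst (Stored (arr s′ #seq) 0) (concat-rowsOf key xs) (Emitted.content e)
                    ; null   = Emitted.null e }
                  ; starts = Emitted.starts e })))
    where
    open Arranged arranged
    length-rows : length (rowsOf key xs) ≡ B
    length-rows = trans (length-map _ (allFin B)) (length-tabulate {n = B} id)

    emissions≡n+B : emissions (rowsOf key xs) ≡ n + B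
    emissions≡n+B = trans (emissions≡ (rowsOf key xs)) (cong₂ _+_
      (trans (cong length (concat-rowsOf key xs))
        (trans (length-map toℕ (bucketSort key xs))
               (enumeration-length (bucketSort-enumeration key enum))))
      length-rows)

    pushed : Pushed key xs n (exec (add $c $n $0) s)
    pushed = record
      { counter = trans (cong₂ _+_ n≡ zero≡) (+-identityʳ n)
      ; unit    = unit
      ; bound   = ≤-reflexive (sym (enumeration-length enum))
      ; stored  = stored
      ; keys    = keys
      ; chains  = λ b → subst (λ ys → Chain _ _ n _ (map toℕ (bucket key ys b)))
                    (sym (trans (cong (λ k → drop k xs) (sym (enumeration-length enum))) (drop-all xs)))
                    (null (toℕ b))
      ; null    = λ i _ → null i
      }

  module _ {n ℓ p τ} {rank : Fin n → Fin ℓ} {column : Fin n → Fin p} {track : Fin n → Fin τ} where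

    private
      Ready : Memory → Set
      Ready = Prepared rank column track

    round-within : ∀ {B} (key : Fin n → Fin B) compute $B {xs s} → LoopFree compute →
      Keeps (fill compute) → (∀ s → reg (exec compute s) $c ≡ reg s $c) →
      (∀ {s} v → Ready s → reg s $c ≡ toℕ v → reg (exec compute s) $a ≡ toℕ (key v)) →
      (∀ {s} → Ready s → reg s $B ≡ B) →
      writesArr compute #seq ≡ false → writesArr compute #head ≡ false → writesArr compute #key ≡ false →
      IsEnumeration xs → n + B ≤ K * X → Ready s → Arranged xs s →
      Within (round compute $B) s (Sorted key xs)
    round-within {B} key compute $B {xs} {s} free keeps keeps-c computes sized seq∉ head∉ key∉
                 enum n+B≤ ready arranged =
      within-exec (add $c $n $0) _
        (within-seq
          (within-loopTime n (≤-trans (m≤m+n n B) n+B≤)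
            (halts-loop Filled $c (fill compute) (_ , free , _) proj₁ step id n filled))
          λ { {s₁} f (_ , _ , ready₁ , keys) → within-exec (add $size $B $0) _
            (sortByKey-within key enum n+B≤ (n≡ ready₁)
              (trans (cong₂ _+_ (sized ready₁) (zero≡ ready₁)) (+-identityʳ B))
              (unit ready₁) (zero≡ ready₁)
              record
                { stored = subst (λ g → Stored g 0 (map toℕ xs)) (sym (arrs f #seq (∨-right seq∉)))
                                 (Arranged.stored arranged)
                ; null   = λ i → trans (cong (λ g → g i) (arrs f #head (∨-right head∉)))
                                       (Arranged.null arranged i) }
              (λ v → keys v z≤n)) })
      where
      open Prepared
      ∨-right : ∀ {x} → x ≡ false → (x ∨ false) ≡ false
      ∨-right refl = refl

      Filled : ℕ → Memory → Set
      Filled k s = reg s $c ≡ k × k ≤ n × Ready s × (∀ v → k ≤ toℕ v → arr s #key (toℕ v) ≡ toℕ (key v))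

      filled : Filled n (exec (add $c $n $0) s)
      filled = trans (cong₂ _+_ (n≡ ready) (zero≡ ready)) (+-identityʳ n) , ≤-refl ,
               prepared-frame {A = add $c $n $0} (refl , refl) (exec-frame (add $c $n $0) _) ready ,
               λ v n≤v → contradiction (Fin.toℕ<n v) (≤⇒≯ n≤v)

      step : ∀ {k s} → Filled (suc k) s → Filled k (exec (fill compute) s)
      step {k} {s} (c≡ , k<n , ready , keys) =
        trans (keeps-c s₁) c₁ , <⇒≤ k<n , prepared-frame keeps (exec-frame (fill compute) (_ , free , _)) ready ,
        keys′
        where
        s₁ = exec (sub $c $c $1) s
        c₁ : reg s $c ∸ reg s $1 ≡ k
        c₁ = cong₂ _∸_ c≡ (unit ready)
        ready₁ : Ready s₁
        ready₁ = prepared-frame {A = sub $c $c $1} (refl , refl) (exec-frame (sub $c $c $1) _) ready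
        v₀ = fromℕ< k<n
        v₀≡ : toℕ v₀ ≡ k
        v₀≡ = toℕ-fromℕ< k<n
        key≡ : arr (exec (fill compute) s) #key ≡ update (arr s #key) k (toℕ (key v₀))
        key≡ = trans
          (cong₂ (update (arr (exec compute s₁) #key)) (trans (keeps-c s₁) c₁)
                 (computes v₀ ready₁ (trans c₁ (sym v₀≡))))
          (cong (λ g → update g k (toℕ (key v₀))) (arrs (exec-frame compute {s₁} free) #key key∉))
        keys′ : ∀ v → k ≤ toℕ v → arr (exec (fill compute) s) #key (toℕ v) ≡ toℕ (key v)
        keys′ v k≤v with m≤n⇒m<n∨m≡n k≤v
        ... | inj₁ k<v = trans (miss key≡ (λ e → <⇒≢ k<v (sym e))) (keys v k<v)
        ... | inj₂ k≡v = trans (hit key≡ (sym k≡v))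
                               (cong (toℕ ∘ key) (toℕ-injective (trans v₀≡ k≡v)))

    sorting-within : ∀ {xs s} → IsEnumeration xs → n + ℓ ≤ K * X → n + p ≤ K * X → n + τ ≤ K * X →
      Ready s → Arranged xs s →
      Within sorting s (λ s′ → Sorted track (bucketSort column (bucketSort rank xs)) s′ × reg s′ 0 ≡ τ)
    sorting-within {xs} enum n+ℓ≤ n+p≤ n+τ≤ ready arranged =
      within-seq (round-within rank rankKey $ℓ _ (refl , refl) (λ _ → refl)
          (λ {s} v r e → trans (cong (λ z → arr s #rank (arr s #base z)) e) (ranks r v))
          ℓ≡ refl refl refl enum n+ℓ≤ ready arranged)
      λ f₁ sorted₁ → let
          ready₁ = prepared-frame (refl , refl) f₁ ready
          enum₁  = bucketSort-enumeration rank enum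
        in within-seq (round-within column columnKey $p _ (refl , refl) (λ _ → refl)
          (λ {s} v r e → trans (cong (arr s #column) e) (columns r v))
          p≡ refl refl refl enum₁ n+p≤ ready₁ (Sorted.arranged sorted₁))
      λ f₂ sorted₂ → let
          ready₂ = prepared-frame (refl , refl) f₂ ready₁
          enum₂  = bucketSort-enumeration column enum₁
        in within-seq (round-within track trackKey $τ _ (refl , refl) (λ _ → refl)
          (λ {s} v r e → trans
            (cong (λ z → arr s #mod (arr s #column z) + arr s #shift (arr s #layer z)
                         + arr s #track (arr s #base z)) e)
            (tracks r v))
          τ≡ refl refl refl enum₂ n+τ≤ ready₂ (Sorted.arranged sorted₂))
      λ f₃ sorted₃ → let ready₃ = prepared-frame (refl , refl) f₃ ready₂
        in within-loopFree (add $n $τ $0) _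
          ( record { arranged = record { stored = Arranged.stored (Sorted.arranged sorted₃)
                                       ; null   = Arranged.null (Sorted.arranged sorted₃) }
                   ; starts   = Sorted.starts sorted₃ }
          , trans (cong₂ _+_ (τ≡ ready₃) (zero≡ ready₃)) (+-identityʳ τ))
      where open Prepared

-- Tables filled by repeated addition

%-suc-< : ∀ i d .{{_ : NonZero d}} → suc (i % d) < d → suc i % d ≡ suc (i % d)
%-suc-< i d lt = begin
  suc i % d                       ≡⟨ cong (λ z → suc z % d) (m≡m%n+[m/n]*n i d) ⟩
  (suc (i % d) + i / d * d) % d   ≡⟨ [m+kn]%n≡m%n (suc (i % d)) (i / d) d ⟩
  suc (i % d) % d                 ≡⟨ m<n⇒m%n≡m lt ⟩
  suc (i % d)                     ∎
  where open ≡-Reasoning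

%-suc-≡ : ∀ i d .{{_ : NonZero d}} → suc (i % d) ≡ d → suc i % d ≡ 0
%-suc-≡ i d eq = begin
  suc i % d                       ≡⟨ cong (λ z → suc z % d) (m≡m%n+[m/n]*n i d) ⟩
  (suc (i % d) + i / d * d) % d   ≡⟨ [m+kn]%n≡m%n (suc (i % d)) (i / d) d ⟩
  suc (i % d) % d                 ≡⟨ cong (_% d) eq ⟩
  d % d                           ≡⟨ n%n≡0 d ⟩
  0                               ∎
  where open ≡-Reasoning

extend : ∀ {f g : ℕ → ℕ} {k a} {F : ℕ → ℕ} → f ≡ update g k a → a ≡ F k →
         (∀ x → x < k → g x ≡ F x) → ∀ x → x < suc k → f x ≡ F x
extend f≡ a≡ old x (s≤s x≤k) with m≤n⇒m<n∨m≡n x≤k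
... | inj₁ x<k  = trans (miss f≡ (<⇒≢ x<k)) (old x x<k)
... | inj₂ refl = trans (hit f≡ refl) a≡

-- `shifts` makes `t * r` rounds although layers are below `r`: the same loop thereby accumulates in
-- `$τ` the product of `t * r` and `2 * h + 1`. `residues` carries a residue and its multiple by
-- `t * r` side by side and resets both at a wrap-around. A round of `walk` places one vertex or
-- moves on to the next track.
multiply shifts residues walk identity : Program
multiply = add $s $s $r ⨟ sub $c $c $1
shifts   = store #shift $i $a ⨟ add $a $a $t ⨟ add $i $i $1 ⨟ add $τ $τ $w ⨟ sub $c $c $1
residues =
  store #mod $i $b ⨟ add $a $a $1 ⨟ add $b $b $s ⨟ sub $d $w $a ⨟
  if $d skip (const $a 0 ⨟ const $b 0) ⨟ add $i $i $1 ⨟ sub $c $c $1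
walk =
  add $a $j $1 ⨟ load $a #offset $a ⨟ sub $a $a $i ⨟
  if $a (load $a #line $i ⨟ store #rank $a $i ⨟ store #track $a $j ⨟ add $i $i $1)
        (add $j $j $1) ⨟
  sub $c $c $1
identity = sub $c $c $1 ⨟ store #seq $c $c

multiplyTable shiftTable residueTable lineTable identityTable tables : Program
multiplyTable =
  (const $1 1 ⨟ const $0 0 ⨟ add $w $h $h ⨟ add $w $w $1 ⨟ const $s 0 ⨟ add $c $t $0) ⨟
  while $c multiply
shiftTable = (const $τ 0 ⨟ const $i 0 ⨟ const $a 0 ⨟ add $c $s $0) ⨟ while $c shifts
residueTable = (const $i 0 ⨟ const $a 0 ⨟ const $b 0 ⨟ add $c $p $0) ⨟ while $c residues
lineTable = (load $ℓ #offset $t ⨟ const $i 0 ⨟ const $j 0 ⨟ add $c $ℓ $t) ⨟ while $c walk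
identityTable = add $c $n $0 ⨟ while $c identity
tables = multiplyTable ⨟ shiftTable ⨟ residueTable ⨟ lineTable ⨟ identityTable

-- In P x q j, the entry x is at position q of the concatenation and in list j.
RowEntries : (P : ℕ → ℕ → ℕ → Set) → ℕ → ℕ → List ℕ → Set
RowEntries P j q []       = ⊤
RowEntries P j q (x ∷ xs) = P x q j × RowEntries P j (suc q) xs

Entries : (P : ℕ → ℕ → ℕ → Set) → ℕ → ℕ → List (List ℕ) → Set
Entries P j q []         = ⊤
Entries P j q (xs ∷ xss) = RowEntries P j q xs × Entries P (suc j) (q + length xs) xss

record Walking (s : Memory) (j q k : ℕ) : Set where
  field
    counter  : reg s $c ≡ k
    unit     : reg s $1 ≡ 1
    row      : reg s $j ≡ j
    position : reg s $i ≡ q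

module _ (P : ℕ → ℕ → ℕ → Set) where

  -- A vertex counts if it is already placed or still to come. A repeated write would again
  -- establish `P`, so the loop can be verified without knowing that the entries are distinct.
  Tabulated : Memory → List ℕ → Memory → Set
  Tabulated s xs s′ = ∀ v → P v (arr s #rank v) (arr s #track v) ⊎ v ∈ xs →
                      P v (arr s′ #rank v) (arr s′ #track v)

  mutual
    walkRow : ∀ xs xss {j q s} → Walking s j q (suc (length xs) + emissions xss) →
              Stored (arr s #offset) (suc j) (offsetsFrom (q + length xs) xss) →
              Stored (arr s #line) q (xs ++ concat xss) →
              RowEntries P j q xs → Entries P (suc j) (q + length xs) xss →
              HaltsWithin (while $c walk) s (loopTime (suc (length xs) + emissions xss) walk)
                (Tabulated s (xs ++ concat xss))
    walkRow [] xss {j} {q} {s} I off line _ es =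
      loop-step counter _ (cong (exec (sub $c $c $1)) (branch-zero rest))
        (walkRows xss record
          { counter = cong₂ _∸_ counter unit ; unit = unit
          ; row = next ; position = position }
          (subst (λ z → Stored (arr s #offset) (suc j) (offsetsFrom z xss)) (+-identityʳ q) off)
          line (subst (λ z → Entries P (suc j) z xss) (+-identityʳ q) es))
      where
      open Walking I
      next : reg s $j + reg s $1 ≡ suc j
      next = trans (cong₂ _+_ row unit) (+-comm j 1)
      rest : arr s #offset (reg s $j + reg s $1) ∸ reg s $i ≡ 0
      rest = trans (cong₂ _∸_ (trans (cong (arr s #offset) next) (stored-offset xss off)) position)
                   (m+n∸m≡n q 0)
    walkRow (x ∷ xs) xss {j} {q} {s} I off (line , lines) (e , es) ess =
      loop-step counter _ (cong (exec (sub $c $c $1)) (branch-suc rest))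
        (halts-map (walkRow xs xss record
          { counter = cong₂ _∸_ counter unit ; unit = unit ; row = row
          ; position = trans (cong₂ _+_ position unit) (+-comm q 1) }
          (subst (λ z → Stored (arr s #offset) (suc j) (offsetsFrom z xss)) (+-suc q (length xs)) off)
          lines es (subst (λ z → Entries P (suc j) z xss) (+-suc q (length xs)) ess))
          λ tabulated v → tabulated v ∘ written v)
      where
      open Walking I
      rest : arr s #offset (reg s $j + reg s $1) ∸ reg s $i ≡ suc (length xs)
      rest = trans (cong₂ _∸_ (trans (cong (arr s #offset)
                                       (trans (cong₂ _+_ row unit) (+-comm j 1)))
                                     (stored-offset xss off)) position)
                   (m+n∸m≡n q (suc (length xs)))
      x≡ : arr s #line (reg s $i) ≡ x
      x≡ = trans (cong (arr s #line) position) line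
      rank′ track′ : ℕ → ℕ
      rank′  = update (arr s #rank) (arr s #line (reg s $i)) (reg s $i)
      track′ = update (arr s #track) (arr s #line (reg s $i)) (reg s $j)
      rank≡ : rank′ ≡ update (arr s #rank) x q
      rank≡ = cong₂ (update (arr s #rank)) x≡ position
      track≡ : track′ ≡ update (arr s #track) x j
      track≡ = cong₂ (update (arr s #track)) x≡ row
      written : ∀ v → P v (arr s #rank v) (arr s #track v) ⊎ v ∈ x ∷ xs ++ concat xss →
                P v (rank′ v) (track′ v) ⊎ v ∈ xs ++ concat xss
      written v v∈ with v ≟ x
      ... | yes refl = inj₁ (subst₂ (P v) (sym (hit rank≡ refl)) (sym (hit track≡ refl)) e)
      written v (inj₁ pv) | no v≢x = inj₁ (subst₂ (P v) (sym (miss rank≡ v≢x)) (sym (miss track≡ v≢x)) pv)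
      written v (inj₂ (here v≡x))  | no v≢x = contradiction v≡x v≢x
      written v (inj₂ (there v∈)) | no _   = inj₂ v∈

    walkRows : ∀ xss {j q s} → Walking s j q (emissions xss) →
               Stored (arr s #offset) j (offsetsFrom q xss) → Stored (arr s #line) q (concat xss) →
               Entries P j q xss →
               HaltsWithin (while $c walk) s (loopTime (emissions xss) walk) (Tabulated s (concat xss))
    walkRows [] I _ _ _ = loop-end (Walking.counter I) λ { v (inj₁ pv) → pv }
    walkRows (xs ∷ xss) I (_ , off) line (es , ess) = walkRow xs xss I off line es ess

-- The closing entry of the offsets is where the program finds the total length, and with it the
-- number of rounds of `walk`.
stored-last : ∀ {f} j k xss → Stored f j (offsetsFrom k xss) → f (j + length xss) ≡ k + length (concat xss)
stored-last {f} j k [] (e , _) = trans (cong f (+-identityʳ j)) (trans e (sym (+-identityʳ k)))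
stored-last {f} j k (xs ∷ xss) (_ , r) = trans (cong f (+-suc j (length xss)))
  (trans (stored-last (suc j) (k + length xs) xss r)
    (trans (+-assoc k (length xs) _) (cong (k +_) (sym (length-++ xs)))))

stored-tabulate : ∀ {n} {A : Set} {f} (F : A → ℕ) o (g : Fin n → A) →
                  (∀ i → f (o + toℕ i) ≡ F (g i)) → Stored f o (map F (tabulate g))
stored-tabulate {zero}      F o g e = tt
stored-tabulate {suc n} {f = f} F o g e =
  trans (cong f (sym (+-identityʳ o))) (e Fin.zero) ,
  stored-tabulate F (suc o) (g ∘ Fin.suc) λ i → trans (cong f (sym (+-suc o (toℕ i)))) (e (Fin.suc i))

module Tables (K X : ℕ) (1≤X : 1 ≤ X) where
  open Linear K X 1≤X

  multiply-within : ∀ {t h r s} → t ≤ K * X → reg s $t ≡ t → reg s $h ≡ h → reg s $r ≡ r →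
    Within multiplyTable s λ s′ →
      (reg s′ $1 ≡ 1 × reg s′ $0 ≡ 0) × reg s′ $w ≡ period h × reg s′ $s ≡ t * r
  multiply-within {t} {h} {r} {s} t≤ t≡ h≡ r≡ =
    within-exec (const $1 1 ⨟ const $0 0 ⨟ add $w $h $h ⨟ add $w $w $1 ⨟ const $s 0 ⨟ add $c $t $0) _
      (within-loopTime t t≤ (halts-loop Multiplied $c multiply _ (proj₁ ∘ proj₂ ∘ proj₂) (λ {_ s} → step {s = s})
        (λ ((u , z , w) , _ , _ , e) → (u , z) , w , trans (sym (+-identityʳ _)) e) t
        ((refl , refl , w≡) , r≡ , trans (+-identityʳ _) t≡ , refl)))
    where
    Multiplied : ℕ → Memory → Set
    Multiplied k s = (reg s $1 ≡ 1 × reg s $0 ≡ 0 × reg s $w ≡ period h) × reg s $r ≡ r ×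
                     reg s $c ≡ k × reg s $s + k * r ≡ t * r
    w≡ : reg s $h + reg s $h + 1 ≡ period h
    w≡ = cong (_+ 1) (trans (cong₂ _+_ h≡ h≡) (cong (h +_) (sym (+-identityʳ h))))
    step : ∀ {k s} → Multiplied (suc k) s → Multiplied k (exec multiply s)
    step {k} {s} ((u , z , w) , r≡ , c≡ , e) =
      (u , z , w) , r≡ , cong₂ _∸_ c≡ u ,
      trans (cong (λ x → reg s $s + x + k * r) r≡) (trans (+-assoc (reg s $s) r (k * r)) e)

  shift-within : ∀ {S t W s} → S ≤ K * X → reg s $s ≡ S → reg s $t ≡ t → reg s $w ≡ W →
    reg s $1 ≡ 1 → reg s $0 ≡ 0 →
    Within shiftTable s λ s′ → reg s′ $τ ≡ S * W × (∀ x → x < S → arr s′ #shift x ≡ x * t)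
  shift-within {S} {t} {W} {s} S≤ s≡ t≡ w≡ u z≡ =
    within-exec (const $τ 0 ⨟ const $i 0 ⨟ const $a 0 ⨟ add $c $s $0) _
      (within-loopTime S S≤ (halts-loop Shifted $c shifts _ proj₁ (λ {_ s} → step {s = s})
        (λ { (_ , _ , x , x≡S , _ , _ , τ≡ , tab) →
          let e = trans (sym (+-identityʳ x)) x≡S in trans τ≡ (cong (_* W) e) ,
          λ y y<S → tab y (subst (y <_) (sym e) y<S) }) S
        (trans (cong₂ _+_ s≡ z≡) (+-identityʳ S) , (u , t≡ , w≡) , 0 , refl , refl , refl , refl , λ _ ())))
    where
    Shifted : ℕ → Memory → Set
    Shifted k s = reg s $c ≡ k × (reg s $1 ≡ 1 × reg s $t ≡ t × reg s $w ≡ W) ×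
      ∃[ x ] (x + k ≡ S × reg s $i ≡ x × reg s $a ≡ x * t × reg s $τ ≡ x * W ×
              (∀ y → y < x → arr s #shift y ≡ y * t))
    step : ∀ {k s} → Shifted (suc k) s → Shifted k (exec shifts s)
    step {k} {s} (c≡ , (u , t≡ , w≡) , x , x+k , i≡ , a≡ , τ≡ , tab) =
      cong₂ _∸_ c≡ u , (u , t≡ , w≡) , suc x , trans (sym (+-suc x k)) x+k ,
      trans (cong₂ _+_ i≡ u) (+-comm x 1) ,
      trans (cong₂ _+_ a≡ t≡) (+-comm (x * t) t) ,
      trans (cong₂ _+_ τ≡ w≡) (+-comm (x * W) W) ,
      extend {F = _* t} (cong (λ j → update (arr s #shift) j (reg s $a)) i≡) a≡ tab

  residue-within : ∀ {p W S s} .{{_ : NonZero W}} → p ≤ K * X →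
    reg s $p ≡ p → reg s $w ≡ W → reg s $s ≡ S → reg s $1 ≡ 1 → reg s $0 ≡ 0 →
    Within residueTable s λ s′ → ∀ x → x < p → arr s′ #mod x ≡ x % W * S
  residue-within {p} {W} {S} {s} p≤ p≡ w≡ s≡ u z≡ =
    within-exec (const $i 0 ⨟ const $a 0 ⨟ const $b 0 ⨟ add $c $p $0) _
      (within-loopTime p p≤ (halts-loop Residues $c residues _ proj₁ (λ {_ s} → step {s = s})
        (λ { (_ , _ , x , x≡p , _ , _ , _ , tab) →
          λ y y<p → tab y (subst (y <_) (trans (sym x≡p) (+-identityʳ x)) y<p) }) p
        (trans (cong₂ _+_ p≡ z≡) (+-identityʳ p) , (u , w≡ , s≡) , 0 , refl , refl ,
         sym 0%W , cong (_* S) (sym 0%W) , λ _ ())))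
    where
    0%W : 0 % W ≡ 0
    0%W = n≤0⇒n≡0 (m%n≤m 0 W)
    Residues : ℕ → Memory → Set
    Residues k s = reg s $c ≡ k × (reg s $1 ≡ 1 × reg s $w ≡ W × reg s $s ≡ S) ×
      ∃[ x ] (x + k ≡ p × reg s $i ≡ x × reg s $a ≡ x % W × reg s $b ≡ x % W * S ×
              (∀ y → y < x → arr s #mod y ≡ y % W * S))
    step : ∀ {k s} → Residues (suc k) s → Residues k (exec residues s)
    step {k} {s} (c≡ , (u , w≡ , s≡) , x , x+k , i≡ , a≡ , b≡ , tab)
      with suc (x % W) <? W
    ... | yes lt = subst (Residues k) (sym (cong (exec (add $i $i $1 ⨟ sub $c $c $1)) (branch-suc d≡)))
        (cong₂ _∸_ c≡ u , (u , w≡ , s≡) , suc x , trans (sym (+-suc x k)) x+k , i′ ,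
         trans a′ (sym (%-suc-< x W lt)) ,
         trans (cong₂ _+_ b≡ s≡) (trans (+-comm _ S) (cong (_* S) (sym (%-suc-< x W lt)))) ,
         table)
      where
      a′ = trans (cong₂ _+_ a≡ u) (+-comm (x % W) 1)
      i′ = trans (cong₂ _+_ i≡ u) (+-comm x 1)
      d≡ : reg s $w ∸ (reg s $a + reg s $1) ≡ suc (W ∸ suc (suc (x % W)))
      -- `W ∸ suc (x % W)` is by computation `suc W ∸ suc (suc (x % W))`, the form to which the
      -- associativity law applies.
      d≡ = trans (cong₂ _∸_ w≡ a′) (+-∸-assoc 1 lt)
      table = extend {F = λ y → y % W * S} (cong (λ j → update (arr s #mod) j (reg s $b)) i≡) b≡ tab
    ... | no ≮W = subst (Residues k) (sym (cong (exec (add $i $i $1 ⨟ sub $c $c $1)) (branch-zero d≡)))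
        (cong₂ _∸_ c≡ u , (u , w≡ , s≡) , suc x , trans (sym (+-suc x k)) x+k , i′ ,
         sym wrap , cong (_* S) (sym wrap) , table)
      where
      a′ = trans (cong₂ _+_ a≡ u) (+-comm (x % W) 1)
      i′ = trans (cong₂ _+_ i≡ u) (+-comm x 1)
      wrap : suc x % W ≡ 0
      wrap = %-suc-≡ x W (≤-antisym (m%n<n x W) (≮⇒≥ ≮W))
      d≡ : reg s $w ∸ (reg s $a + reg s $1) ≡ 0
      d≡ = trans (cong₂ _∸_ w≡ a′) (m≤n⇒m∸n≡0 (≮⇒≥ ≮W))
      table = extend {F = λ y → y % W * S} (cong (λ j → update (arr s #mod) j (reg s $b)) i≡) b≡ tab

  identity-within : ∀ {n s} → n ≤ K * X → reg s $n ≡ n → reg s $1 ≡ 1 → reg s $0 ≡ 0 →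
    Within identityTable s λ s′ → Stored (arr s′ #seq) 0 (map toℕ (allFin n))
  identity-within {n} {s} n≤ n≡ u z≡ =
    within-exec (add $c $n $0) _
      (within-loopTime n n≤ (halts-loop Identity $c identity _ proj₁ (λ {_ s} → step {s = s})
        (λ (_ , _ , e) → stored-tabulate toℕ 0 id (λ i → e (toℕ i) z≤n (Fin.toℕ<n i))) n
        (trans (cong₂ _+_ n≡ z≡) (+-identityʳ n) , u , λ i n≤i i<n → contradiction i<n (≤⇒≯ n≤i))))
    where
    Identity : ℕ → Memory → Set
    Identity k s = reg s $c ≡ k × reg s $1 ≡ 1 × (∀ i → k ≤ i → i < n → arr s #seq i ≡ i)
    step : ∀ {k s} → Identity (suc k) s → Identity k (exec identity s)
    step {k} {s} (c≡ , u , e) = c′ , u , e′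
      where
      c′ = cong₂ _∸_ c≡ u
      seq≡ : arr (exec identity s) #seq ≡ update (arr s #seq) k k
      seq≡ = cong₂ (update (arr s #seq)) c′ c′
      e′ : ∀ i → k ≤ i → i < n → arr (exec identity s) #seq i ≡ i
      e′ i k≤i i<n with m≤n⇒m<n∨m≡n k≤i
      ... | inj₁ k<i  = trans (miss seq≡ (λ q → <⇒≢ k<i (sym q))) (e i k<i i<n)
      ... | inj₂ refl = hit seq≡ refl

-- The line of a track layout

drop-cons : ∀ {A : Set} q (zs : List A) {x ys} → drop q zs ≡ x ∷ ys →
            (∃[ k ] (toℕ k ≡ q × lookup zs k ≡ x)) × drop (suc q) zs ≡ ys
drop-cons zero    (z ∷ zs) refl = (Fin.zero , refl , refl) , refl
drop-cons (suc q) (z ∷ zs) e with drop-cons q zs e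
... | (k , k≡ , l) , d = (Fin.suc k , cong suc k≡ , l) , d

module _ {m t} {H : Graph (Fin m)} {L : TrackLayout H t} {s} (holds : Holds s L) where
  open TrackLayout L
  open Holds holds
  open Ranking (ranking L holds)

  private
    ℓ = line L holds

  concat-rows : concat rows ≡ map toℕ ℓ
  concat-rows = trans (cong concat (trans (map-cong (λ i → map-∘ (ordered i)) (allFin t))
                                          (map-∘ (allFin t))))
                      (concat-map (map (λ i → map proj₁ (ordered i)) (allFin t)))

  -- Phrased on bare numbers because the walk knows nothing of `Fin m`; the vertex is recovered
  -- later by injectivity of `toℕ`.
  IsPlaced : ℕ → ℕ → ℕ → Set
  IsPlaced x q j = ∃[ v ] (toℕ v ≡ x × q ≡ toℕ (rank v) × j ≡ toℕ (track v))

  private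
    -- Ranks are positions in the whole line, so the induction over one row keeps its place there
    -- through `drop q ℓ`.
    rowEntries : ∀ {i} (ys : List (Track i)) {q zs} → drop q ℓ ≡ map proj₁ ys ++ zs →
                 RowEntries IsPlaced (toℕ i) q (map (toℕ ∘ proj₁) ys)
                 × drop (q + length (map (toℕ ∘ proj₁) ys)) ℓ ≡ zs
    rowEntries []       {q} e = tt , trans (cong (λ k → drop k ℓ) (+-identityʳ q)) e
    rowEntries ((v , v∈i) ∷ ys) {q} e with drop-cons q ℓ e
    ... | (k , k≡ , refl) , d with rowEntries ys {suc q} d
    ...   | es , d′ =
      ((v , refl , trans (sym k≡) (sym (cong toℕ (rank-lookup L holds k))) , cong toℕ (sym v∈i)) , es) ,
      trans (cong (λ k → drop k ℓ) (+-suc q _)) d′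

    -- Generalised from `allFin` to `tabulate g`, since the tail of `allFin` is not itself of the
    -- form `allFin`.
    entries : ∀ {k} (g : Fin k → Fin t) j q → (∀ i → toℕ (g i) ≡ j + toℕ i) →
              drop q ℓ ≡ concat (map (λ i → map proj₁ (ordered i)) (tabulate g)) →
              Entries IsPlaced j q (map (λ i → map (toℕ ∘ proj₁) (ordered i)) (tabulate g))
    entries {zero}  g j q e d = tt
    entries {suc k} g j q e d with rowEntries (ordered (g Fin.zero)) d
    ... | es , d′ =
      subst (λ i → RowEntries IsPlaced i q (map (toℕ ∘ proj₁) (ordered (g Fin.zero))))
            (trans (e Fin.zero) (+-identityʳ j)) es ,
      entries (g ∘ Fin.suc) (suc j) _ (λ i → trans (e (Fin.suc i)) (+-suc j (toℕ i))) d′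

  placed : Entries IsPlaced 0 0 rows
  placed = entries id 0 0 (λ _ → refl) refl

-- Output

map-proj₁-toList : ∀ {A : Set} {P : A → Set} {xs} (ps : All P xs) → map proj₁ (All.toList ps) ≡ xs
map-proj₁-toList []       = refl
map-proj₁-toList (_ ∷ ps) = cong (_ ∷_) (map-proj₁-toList ps)

module _ {n p m h r t ℓ} {H : Graph (Fin m)} {G : Graph (Fin n)}
         (G⊆ : G ⊆ᴳ path p ^ᴳ h ⊠ complete r ⊠ H) (L : TrackLayout H t) (R : Ranking L ℓ) where
  open Composite G⊆ L R
  open Ranking R using (rank)
  open TrackLayout layout using (Track; _≺_)

  arrangement : List (Fin n)
  arrangement = bucketSort column (bucketSort (rank ∘ base) (allFin n))

  allFin-enumeration : IsEnumeration (allFin n)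
  allFin-enumeration = Unique.allFin⁺ n , ∈-allFin

  holdsLayout : ∀ {s} → Sorted trackOf arrangement s → reg s 0 ≡ period h * r * t → Holds s layout
  holdsLayout {s} S τ≡ = record
    { ordered   = ordered
    ; sorted    = λ i → AllPairs.map (λ {u} {v} → Before-refine (trans (proj₂ u) (sym (proj₂ v))))
        (AllPairs.map⁻ (subst (AllPairs _) (sym (ordered-bucket i))
          (AllPairs.filter⁺ (λ v → trackOf v Fin.≟ i)
            (bucketSort-sorted column (bucketSort-sorted (rank ∘ base) (Unique.allFin⁺ n))))))
    ; covers    = covers
    ; count     = τ≡
    ; positions = stored-lookup 0 _
        (subst (λ xss → Stored (arr s #start) 0 (offsets xss)) (sym rows≡) (Sorted.starts S))
    ; contents  = stored-lookup 0 _
        (subst (Stored (arr s #seq) 0) (sym (trans (cong concat rows≡) (concat-rowsOf trackOf arrangement)))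
               (Arranged.stored (Sorted.arranged S)))
    }
    where
    -- The format asks for lists over `Track i`; filtering itself supplies the proofs with which the
    -- members of a bucket are paired.
    ordered : ∀ i → List (Track i)
    ordered i = All.toList (all-filter (λ v → trackOf v Fin.≟ i) arrangement)

    ordered-bucket : ∀ i → map proj₁ (ordered i) ≡ bucket trackOf arrangement i
    ordered-bucket i = map-proj₁-toList (all-filter (λ v → trackOf v Fin.≟ i) arrangement)

    rows≡ : map (λ i → map (toℕ ∘ proj₁) (ordered i)) (allFin _) ≡ rowsOf trackOf arrangement
    rows≡ = map-cong (λ i → trans (map-∘ (ordered i)) (cong (map toℕ) (ordered-bucket i))) (allFin _)

    arranges : ∀ v → v ∈ arrangement
    arranges v = ∈-bucketSort column (∈-bucketSort (rank ∘ base) (∈-allFin v))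

    covers : ∀ i (v : Track i) → v ∈ ordered i
    covers i (v , refl) with ∈-map⁻ proj₁ (subst (v ∈_) (sym (ordered-bucket i))
                                                 (∈-bucket trackOf (arranges v)))
    ... | (v , refl) , v∈ , refl = v∈

-- Tables

module _ {n p m h r t} {H : Graph (Fin m)} {G : Graph (Fin n)}
         (G⊆ : G ⊆ᴳ path p ^ᴳ h ⊠ complete r ⊠ H) {L : TrackLayout H t}
         {s₀} (holds : Holds s₀ L) where
  open Composite G⊆ L (ranking L holds)
  open Holds holds using (rows)

  record Loaded (s : Memory) : Set where
    field
      n≡      : reg s $n ≡ n
      t≡      : reg s $t ≡ t
      p≡      : reg s $p ≡ p
      h≡      : reg s $h ≡ h
      r≡      : reg s $r ≡ r
      offset  : Stored (arr s #offset) 0 (offsets rows)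
      content : Stored (arr s #line) 0 (concat rows)
      columns : ∀ v → arr s #column (toℕ v) ≡ toℕ (column v)
      layers  : ∀ v → arr s #layer (toℕ v) ≡ toℕ (layer v)
      bases   : ∀ v → arr s #base (toℕ v) ≡ toℕ (base v)
      null    : ∀ i → arr s #head i ≡ 0

  record Tabled (s : Memory) : Set where
    field
      τ≡       : reg s $τ ≡ period h * r * t
      ℓ≡       : reg s $ℓ ≡ length (line L holds)
      unit     : reg s $1 ≡ 1
      zero≡    : reg s $0 ≡ 0
      shifted  : ∀ x → x < t * r → arr s #shift x ≡ x * t
      reduced  : ∀ x → x < p → arr s #mod x ≡ (x % period h) {{period-nonZero h}} * (t * r)
      places   : ∀ v → v ∈ concat rows → IsPlaced holds v (arr s #rank v) (arr s #track v)
      sequence : Stored (arr s #seq) 0 (map toℕ (allFin n))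

module Setup (K X : ℕ) (1≤X : 1 ≤ X) where
  open Linear K X 1≤X
  open Tables K X 1≤X

  line-within : ∀ (P : ℕ → ℕ → ℕ → Set) {rows s} → length (concat rows) + length rows ≤ K * X →
    reg s $t ≡ length rows → reg s $1 ≡ 1 →
    Stored (arr s #offset) 0 (offsets rows) → Stored (arr s #line) 0 (concat rows) →
    Entries P 0 0 rows →
    Within lineTable s λ s′ → reg s′ $ℓ ≡ length (concat rows) ×
      (∀ v → v ∈ concat rows → P v (arr s′ #rank v) (arr s′ #track v))
  line-within P {rows} {s} ≤KX t≡ u off line es =
    within-exec (load $ℓ #offset $t ⨟ const $i 0 ⨟ const $j 0 ⨟ add $c $ℓ $t) _
      (within-map
        (within-loopTime (emissions rows) (≤-trans (≤-reflexive (emissions≡ rows)) ≤KX)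
          (walkRows P rows record
            { counter = trans (cong₂ _+_ ℓ≡ t≡) (sym (emissions≡ rows))
            ; unit = u ; row = refl ; position = refl }
            off line es))
        λ f tab → trans (regs f $ℓ refl) ℓ≡ , λ v v∈ → tab v (inj₂ v∈))
    where
    ℓ≡ : arr s #offset (reg s $t) ≡ length (concat rows)
    ℓ≡ = trans (cong (arr s #offset) t≡) (stored-last 0 0 rows off)

  module _ {n p m h r t} {H : Graph (Fin m)} {G : Graph (Fin n)}
           (G⊆ : G ⊆ᴳ path p ^ᴳ h ⊠ complete r ⊠ H) {L : TrackLayout H t}
           {s₀} (holds : Holds s₀ L) where
    open Composite G⊆ L (ranking L holds)
    open Ranking (ranking L holds) using (rank)
    open Holds holds using (rows)

    tables-within : ∀ {s} → n ≤ K * X → p ≤ K * X → t ≤ K * X → t * r ≤ K * X →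
      length (line L holds) + t ≤ K * X → Loaded G⊆ holds s →
      Within tables s λ s′ → Prepared (rank ∘ base) column trackOf s′ × Arranged (allFin n) s′
    tables-within {s} n≤ p≤ t≤ tr≤ ℓ+t≤ I =
      within-map {Q = Tabled G⊆ holds}
        (within-seq (multiply-within t≤ t≡ h≡ r≡)
          λ { f₁ ((u₁ , z₁) , w₁ , s₁≡) →
        within-seq (shift-within tr≤ s₁≡ (trans (regs f₁ $t refl) t≡) w₁ u₁ z₁)
          λ { f₂ (τ≡ , shifts) →
        within-seq (residue-within {{period-nonZero h}} p≤
            (trans (regs f₂ $p refl) (trans (regs f₁ $p refl) p≡))
            (trans (regs f₂ $w refl) w₁) (trans (regs f₂ $s refl) s₁≡)
            (trans (regs f₂ $1 refl) u₁) (trans (regs f₂ $0 refl) z₁))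
          λ { {s₃} f₃ residues → let
            f₁₂₃ = frame-seq f₁ (frame-seq f₂ f₃)
            u₃ = trans (regs f₃ $1 refl) (trans (regs f₂ $1 refl) u₁)
            z₃ = trans (regs f₃ $0 refl) (trans (regs f₂ $0 refl) z₁) in
        within-seq (line-within (IsPlaced holds)
            (≤-trans (≤-reflexive (cong₂ _+_ length-content length-rows)) ℓ+t≤)
            (trans (regs f₁₂₃ $t refl) (trans t≡ (sym length-rows)))
            u₃
            (subst (λ g → Stored g 0 (offsets rows)) (sym (arrs f₁₂₃ #offset refl)) offset)
            (subst (λ g → Stored g 0 (concat rows)) (sym (arrs f₁₂₃ #line refl)) content)
            (placed holds))
          λ { {s₄} f₄ (ℓ≡ , places) → let
            f₁₋₄ = frame-seq f₁₂₃ f₄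
            u₄ = trans (regs f₄ $1 refl) u₃
            z₄ = trans (regs f₄ $0 refl) z₃ in
        within-map (identity-within n≤ (trans (regs f₁₋₄ $n refl) n≡) u₄ z₄)
          λ {s′} f₅ seq → let
            τ₅ = trans (regs f₅ $τ refl) (trans (regs f₄ $τ refl) (trans (regs f₃ $τ refl) τ≡))
            f₄₅ = frame-seq f₄ f₅
            f₃₄₅ = frame-seq f₃ f₄₅
          in record
            { τ≡       = trans τ₅ τ-comm
            ; ℓ≡       = trans (regs f₅ $ℓ refl) (trans ℓ≡ length-content)
            ; unit     = trans (regs f₅ $1 refl) u₄
            ; zero≡    = trans (regs f₅ $0 refl) z₄
            ; shifted  = λ x x< → trans (cong (λ g → g x) (arrs f₃₄₅ #shift refl)) (shifts x x<)
            ; reduced  = λ x x< → trans (cong (λ g → g x) (arrs f₄₅ #mod refl)) (residues x x<)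
            ; places   = λ v v∈ → subst₂ (λ f g → IsPlaced holds v (f v) (g v))
                (sym (arrs f₅ #rank refl)) (sym (arrs f₅ #track refl)) (places v v∈)
            ; sequence = seq
            } } } } })
        λ {s′} f tabled → let
              open Tabled tabled
              columns′ = λ v → trans (cong (λ g → g (toℕ v)) (arrs f #column refl)) (columns v)
              layers′  = λ v → trans (cong (λ g → g (toℕ v)) (arrs f #layer refl)) (layers v)
              bases′   = λ v → trans (cong (λ g → g (toℕ v)) (arrs f #base refl)) (bases v)
              placed′  = λ v → placement {s′} (places (toℕ (base v)) (∈-content (base v)))
            in record
              { n≡      = trans (regs f $n refl) n≡
              ; p≡      = trans (regs f $p refl) p≡
              ; τ≡      = τ≡
              ; ℓ≡      = ℓ≡
              ; unit    = unit
              ; zero≡   = zero≡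
              ; ranks   = λ v → trans (cong (arr s′ #rank) (bases′ v)) (proj₁ (placed′ v))
              ; columns = columns′
              ; tracks  = λ v → trans
                  (cong₂ _+_ (cong₂ _+_
                    (trans (cong (arr s′ #mod) (columns′ v)) (reduced (toℕ (column v)) (toℕ<n (column v))))
                    (trans (cong (arr s′ #shift) (layers′ v))
                      (shifted (toℕ (layer v)) (layer-bound v))))
                    (trans (cong (arr s′ #track) (bases′ v)) (proj₂ (placed′ v))))
                  (trans (index-comm _ (toℕ (layer v)) _) (sym (toℕ-trackOf v)))
              } , record
              { stored = sequence
              ; null   = λ i → trans (cong (λ g → g i) (arrs f #head refl)) (null i) }
      where
      open Loaded I
      length-rows : length rows ≡ t
      length-rows = trans (length-map _ (allFin t)) (length-tabulate {n = t} id)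
      length-content : length (concat rows) ≡ length (line L holds)
      length-content = trans (cong length (concat-rows holds)) (length-map toℕ (line L holds))
      ∈-content : ∀ v → toℕ v ∈ concat rows
      ∈-content v = subst (toℕ v ∈_) (sym (concat-rows holds)) (∈-map⁺ toℕ (∈-line L holds v))
      placement : ∀ {s v} → IsPlaced holds (toℕ v) (arr s #rank (toℕ v)) (arr s #track (toℕ v)) →
                  arr s #rank (toℕ v) ≡ toℕ (rank v) × arr s #track (toℕ v) ≡ toℕ (TrackLayout.track L v)
      placement (v , e , r , t) with toℕ-injective e
      ... | refl = r , t
      layer-bound : ∀ v → toℕ (layer v) < t * r
      layer-bound v = <-≤-trans (toℕ<n (layer v))
        (≤-trans (≤-reflexive (sym (*-identityˡ r)))
                 -- `t` is positive because `base v` lies on some track.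
                 (*-monoˡ-≤ r (≤-trans (s≤s z≤n) (toℕ<n (TrackLayout.track L (base v))))))
      open +-*-Solver
      τ-comm : t * r * period h ≡ period h * r * t
      τ-comm = solve 3 (λ t r w → t :* r :* w := w :* r :* t) refl t r (period h)
      index-comm : ∀ a b c → a * (t * r) + b * t + c ≡ t * (r * a + b) + c
      index-comm = λ a b c → solve 5 (λ a b c t r →
        a :* (t :* r) :+ b :* t :+ c := t :* (r :* a :+ b) :+ c) refl a b c t r

-- The subroutine finds H where the decomposition stores it: m in register 1, lists in arrays 2 and 3.
subReg subArr : ℕ → ℕ
subReg zero          = 1
subReg (suc x)       = 21 + x
subArr zero          = 2
subArr (suc zero)    = 3
subArr (suc (suc a)) = 15 + a

subReg-injective : ∀ {x y} → subReg x ≡ subReg y → x ≡ y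
subReg-injective {zero}  {zero}  _ = refl
subReg-injective {suc x} {suc y} e = cong suc (+-cancelˡ-≡ 21 x y e)

subArr-injective : ∀ {a b} → subArr a ≡ subArr b → a ≡ b
subArr-injective {zero}        {zero}        _ = refl
subArr-injective {zero}        {suc zero}    ()
subArr-injective {zero}        {suc (suc _)} ()
subArr-injective {suc zero}    {suc zero}    _ = refl
subArr-injective {suc (suc a)} {suc (suc b)} e = cong (2 +_) (+-cancelˡ-≡ 15 a b e)

-- The algorithm and its running time

algorithm : Program → Program
algorithm A = rename subReg subArr A ⨟ tables ⨟ sorting

at-tabulate : ∀ {n} {A : Set} (c : A → ℕ) (g : Fin n → A) v → at 0 (map c (tabulate g)) (toℕ v) ≡ c (g v)
at-tabulate c g Fin.zero    = refl
at-tabulate c g (Fin.suc v) = at-tabulate c (g ∘ Fin.suc) v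

mainTheorem2 :
    Σ[ alg ∈ (Program → Program) ]
    ∀ (C : ℕ) → ∃[ c ]
    ∀ (A : Program) (f : ℕ → ∀ {m} → Graph (Fin m) → ℕ)
      {n p m : ℕ} (h r t : ℕ) → 1 ≤ h → 1 ≤ r →
      (H : Graph (Fin m)) (G : Graph (Fin n))
      (G⊆ : G ⊆ᴳ path p ^ᴳ h ⊠ complete r ⊠ H)
      (LG : AdjacencyLists G) (LH : AdjacencyLists H) →
      p + m ≤ C * n →
      HaltsWithin A (graphInput LH) (f t H)
        (λ s → Σ[ L ∈ TrackLayout H t ] (TrackLayout.NoEmptyTracks L × Holds s L)) →
      HaltsWithin (alg A) (decompositionInput h r G⊆ LG LH)
        (c * (n + h * r * t + f t H))
        (λ s → ∃[ τ ] (τ ≤ (2 * h + 1) * r * t × Σ[ L ∈ TrackLayout G τ ] Holds s L))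
-- The `1` pays for the subroutine, whose run is within `f t H` and hence within `X`. The other
-- summand is computed from fixed program text, so the constant depends on `C` only.
mainTheorem2 = algorithm , λ C → 1 + budget (C + 4) (tables ⨟ sorting) , correct C
  where
  correct : ∀ C (A : Program) (f : ℕ → ∀ {m} → Graph (Fin m) → ℕ)
      {n p m : ℕ} (h r t : ℕ) → 1 ≤ h → 1 ≤ r →
      (H : Graph (Fin m)) (G : Graph (Fin n))
      (G⊆ : G ⊆ᴳ path p ^ᴳ h ⊠ complete r ⊠ H)
      (LG : AdjacencyLists G) (LH : AdjacencyLists H) →
      p + m ≤ C * n →
      HaltsWithin A (graphInput LH) (f t H)
        (λ s → Σ[ L ∈ TrackLayout H t ] (TrackLayout.NoEmptyTracks L × Holds s L)) →
      HaltsWithin (algorithm A) (decompositionInput h r G⊆ LG LH)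
        ((1 + budget (C + 4) (tables ⨟ sorting)) * (n + h * r * t + f t H))
        (λ s → ∃[ τ ] (τ ≤ (2 * h + 1) * r * t × Σ[ L ∈ TrackLayout G τ ] Holds s L))
  correct C A f {n} {p} {m} h r t 1≤h 1≤r H G G⊆ LG LH p+m≤ (s , k , A⇓ , k≤ , L , _ , holds) =
    let s⁺ , A⁺ , simulates = rename-⇓ subReg subArr subReg-injective subArr-injective A⇓ start in
    halts-seq X 1 (budget K (tables ⨟ sorting))
      (framed {Q = λ s′ → Simulates subReg subArr s′ s}
        (s⁺ , k , A⁺ , ≤-trans k≤ (≤-trans f≤X (≤-reflexive (sym (*-identityˡ X)))) , simulates))
      λ (simulates , frame) →
        within-seq (tables-within G⊆ holds
            (fits z≤n n≤4X) (≤-trans (m≤m+n p 0) (fits p≤CX z≤n)) (fits z≤n t≤4X) (fits z≤n tr≤4X)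
            (fits ℓ≤CX t≤4X) (loaded simulates frame))
          λ _ (prepared , arranged) →
            within-map (sorting-within (allFin-enumeration G⊆ L R)
                (≤-trans (≤-reflexive (+-comm n ℓ)) (fits ℓ≤CX n≤4X))
                (≤-trans (≤-reflexive (+-comm n p)) (fits p≤CX n≤4X))
                (fits z≤n (+-mono-≤ n≤X τ≤3X)) prepared arranged)
              λ _ (sorted , τ≡) →
                period h * r * t , ≤-refl , Composite.layout G⊆ L R , holdsLayout G⊆ L R sorted τ≡
    where
    -- `C * X` accounts for the path or for `H`, and `4 * X` for `n` together with the at most
    -- `3 * X` tracks.
    K = C + 4
    X = n + h * r * t + f t H
    R = ranking L holds
    ℓ = length (line L holds)
    input = decompositionInput h r G⊆ LG LH

    start : Simulates subReg subArr input (graphInput LH)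
    start = sim (λ { zero → refl ; (suc x) → refl })
                (λ { zero i → refl ; (suc zero) i → refl ; (suc (suc a)) i → refl })

    loaded : ∀ {s′} → Simulates subReg subArr s′ s → Frame (rename subReg subArr A) input s′ →
             Loaded G⊆ holds s′
    loaded {s′} simulates frame = record
      { n≡      = kept $n λ { zero → refl ; (suc _) → refl }
      ; t≡      = trans (regs≡ simulates 0) (Holds.count holds)
      ; p≡      = kept $p λ { zero → refl ; (suc _) → refl }
      ; h≡      = kept $h λ { zero → refl ; (suc _) → refl }
      ; r≡      = kept $r λ { zero → refl ; (suc _) → refl }
      ; offset  = stored-cong 0 _ (arrs≡ simulates 0) (lookup-stored 0 _ (Holds.positions holds))
      ; content = stored-cong 0 _ (arrs≡ simulates 1) (lookup-stored 0 _ (Holds.contents holds))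
      ; columns = coordinate #column (λ { zero → refl ; (suc zero) → refl ; (suc (suc _)) → refl })
                             (at-tabulate (toℕ ∘ column) id)
      ; layers  = coordinate #layer (λ { zero → refl ; (suc zero) → refl ; (suc (suc _)) → refl })
                             (at-tabulate (toℕ ∘ layer) id)
      ; bases   = coordinate #base (λ { zero → refl ; (suc zero) → refl ; (suc (suc _)) → refl })
                             (at-tabulate (toℕ ∘ base) id)
      ; null    = λ i → cong (λ g → g i) (arrs frame #head (rename-¬writesArr subReg subArr A #head
                    λ { zero → refl ; (suc zero) → refl ; (suc (suc _)) → refl }))
      }
      where
      open Composite G⊆ L R
      kept : ∀ z → (∀ x → (z ≡ᵇ subReg x) ≡ false) → reg s′ z ≡ reg input z
      kept z ∉ = regs frame z (rename-¬writesReg subReg subArr A z ∉)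
      coordinate : ∀ b → (∀ a → (b ≡ᵇ subArr a) ≡ false) → ∀ {c : Fin n → ℕ} →
                   (∀ v → arr input b (toℕ v) ≡ c v) → ∀ v → arr s′ b (toℕ v) ≡ c v
      coordinate b ∉ e v =
        trans (cong (λ g → g (toℕ v)) (arrs frame b (rename-¬writesArr subReg subArr A b ∉))) (e v)

    f≤X : f t H ≤ X
    f≤X = m≤n+m (f t H) _

    1≤X : 1 ≤ X
    1≤X = ≤-trans (⇓-cost A⇓) (≤-trans k≤ f≤X)

    n≤X : n ≤ X
    n≤X = ≤-trans (m≤m+n n _) (m≤m+n _ (f t H))

    hrt≤X : h * r * t ≤ X
    hrt≤X = ≤-trans (m≤n+m (h * r * t) n) (m≤m+n _ (f t H))

    fits : ∀ {x y} → x ≤ C * X → y ≤ 4 * X → x + y ≤ K * X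
    fits x≤ y≤ = ≤-trans (+-mono-≤ x≤ y≤) (≤-reflexive (sym (*-distribʳ-+ X C 4)))

    4X : ∀ {x} → x ≤ X → x ≤ 4 * X
    4X x≤X = ≤-trans x≤X (m≤m+n X (3 * X))

    n≤4X : n ≤ 4 * X
    n≤4X = 4X n≤X

    t≤4X : t ≤ 4 * X
    t≤4X = 4X (≤-trans (≤-trans (≤-reflexive (sym (*-identityˡ t)))
                                (*-monoˡ-≤ t (*-mono-≤ 1≤h 1≤r))) hrt≤X)

    tr≤4X : t * r ≤ 4 * X
    tr≤4X = 4X (≤-trans (≤-reflexive (trans (*-comm t r) (cong (_* t) (sym (*-identityˡ r)))))
                        (≤-trans (*-monoˡ-≤ t (*-monoˡ-≤ r 1≤h)) hrt≤X))

    p≤CX : p ≤ C * X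
    p≤CX = ≤-trans (m≤m+n p m) (≤-trans p+m≤ (*-monoʳ-≤ C n≤X))

    ℓ≤CX : ℓ ≤ C * X
    ℓ≤CX = ≤-trans (unique⇒length≤ (line-unique L holds))
             (≤-trans (m≤n+m m p) (≤-trans p+m≤ (*-monoʳ-≤ C n≤X)))

    τ≤3X : period h * r * t ≤ 3 * X
    τ≤3X = begin
      -- Since `1 ≤ h`, the period is at most `3 * h`, which is the source of the factor 3.
      (2 * h + 1) * r * t   ≤⟨ *-monoˡ-≤ t (*-monoˡ-≤ r (+-monoʳ-≤ (2 * h) 1≤h)) ⟩
      (2 * h + h) * r * t   ≡⟨ solve 3 (λ h r t → (con 2 :* h :+ h) :* r :* t := con 3 :* (h :* r :* t)) refl h r t ⟩
      3 * (h * r * t)       ≤⟨ *-monoʳ-≤ 3 hrt≤X ⟩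
      3 * X                 ∎
      where
      open ≤-Reasoning
      open +-*-Solver

    open Linear K X 1≤X
    open Sorting K X 1≤X
    open Setup K X 1≤X
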